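{- The day-dependent model can be approximated in polynomial time within factor $2$ of optimal. That is, there is a polynomial-time algorithm that, given any instance of the day-dependent fair repetitive scheduling problem (with $n$ clients, $m$ days and integer-valued processing times $(p_{i,j})_{i\in[m],j\in[n]}$), computes a schedule $\pi$ with $K(\pi)\le 2K^*$, where $K^*$ is the optimal objective value of the instance.
   Context: Notation: $[k]=\{1,\dots,k\}$. An instance of the day-dependent fair repetitive scheduling problem (the day-dependent model) consists of $n$ clients, a planning horizon of $m$ days, and for each day $i\in[m]$ and client $j\in[n]$ a single job $(i,j)$ with an integer-valued processing time $p_{i,j}$, which may vary across days. On each day all $n$ jobs of that day are available at time $0$ and are to be processed non-preemptively on a single machine. A schedule (feasible solution) is a sequence $\pi=(\pi_1,\dots,\pi_m)$ of permutations of $[n]$, where $\pi_i(j)$ is the position of job $(i,j)$ in the processing order of day $i$. The completion time of job $(i,j)$ is $C_{i,j}(\pi)=\sum_{\ell\in[n]:\,\pi_i(\ell)\le\pi_i(j)}p_{i,\ell}$, the total completion time of client $j$ is $C_j(\pi)=\sum_{i\in[m]}C_{i,j}(\pi)$, and the objective is to minimize $K(\pi)=\max_{j\in[n]}C_j(\pi)$ over all schedules $\pi$. The optimal value is $K^*=\min_\pi K(\pi)$. -}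

module Defs where

open import Data.Nat.Base using (ℕ; zero; suc; _+_; _*_; _∸_; _/_; _⊔_; _≤_; _<_)
open import Data.Nat.Properties
  using (_≟_; _≤?_; _<?_; ≤-refl; ≤-reflexive; ≤-trans; ≤-total; ≤-antisym; +-0-commutativeMonoid)
open import Data.Nat.Logarithm using (⌊log₂_⌋)
open import Data.Fin.Base using (Fin; zero; suc; toℕ; fromℕ<; remQuot; combine; punchIn)
open import Data.Fin.Permutation
  using (Permutation′; _⟨$⟩ʳ_; _≈_; id; insert; remove; insert-remove)
import Data.Fin.Properties as Fin
open import Data.Product.Base using (∃-syntax; _×_; _,_; proj₁; proj₂; uncurry)
open import Data.Sum.Base using (inj₁; inj₂)
open import Data.Vec.Functional using (Vector; foldr)
open import Data.Bool.Base using (if_then_else_)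
open import Relation.Nullary using (Dec; yes; no; does; contradiction)
open import Relation.Binary.PropositionalEquality
  using (_≡_; _≢_; refl; sym; cong; cong₂)
open import Algebra.Properties.CommutativeMonoid.Sum +-0-commutativeMonoid
  using (sum-syntax; sum-cong-≗)

------------------------------------------------------------------------
-- Fair repetitive scheduling, day-dependent model

record Instance : Set where
  field
    clients : ℕ
    days    : ℕ
    p       : Fin days → Fin clients → ℕ

-- π i ⟨$⟩ʳ j is the position (counted from 0) of job (i , j) on day i.
Schedule : Instance → Set
Schedule I = Fin days → Permutation′ clients
  where open Instance I

max : ∀ {n} → Vector ℕ n → ℕ
max = foldr _⊔_ 0

module _ (I : Instance) where
  open Instance I

  completionTime : Schedule I → Fin days → Fin clients → ℕ
  completionTime π i j =
    ∑[ ℓ < clients ]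
      (if does (toℕ (π i ⟨$⟩ʳ ℓ) ≤? toℕ (π i ⟨$⟩ʳ j)) then p i ℓ else 0)

  totalCompletionTime : Schedule I → Fin clients → ℕ
  totalCompletionTime π j = ∑[ i < days ] completionTime π i j

  -- For an instance without clients this is 0.
  K : Schedule I → ℕ
  K π = max (totalCompletionTime π)

------------------------------------------------------------------------
-- Existence of an optimal schedule.  Permutations carry inverse proofs and
-- schedules are functions, so minimisation is done for objectives that
-- respect pointwise equality.

min-Fin : ∀ n (f : Fin (suc n) → ℕ) → ∃[ i ] (∀ j → f i ≤ f j)
min-Fin zero    f = zero , λ { zero → ≤-refl }
min-Fin (suc n) f with min-Fin n (λ i → f (suc i))
... | i , least with ≤-total (f zero) (f (suc i))
...   | inj₁ le = zero , λ { zero → ≤-refl ; (suc j) → ≤-trans le (least j) }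
...   | inj₂ ge = suc i , λ { zero → ge ; (suc j) → least j }

insert-cong : ∀ {n} (j : Fin (suc n)) {π ρ : Permutation′ n} →
              π ≈ ρ → insert zero j π ≈ insert zero j ρ
insert-cong j {π} {ρ} π≈ρ k with zero Fin.≟ k
... | yes _ = refl
... | no  _ = cong (punchIn j) (π≈ρ _)

min-Permutation : ∀ n (f : Permutation′ n → ℕ) →
                  (∀ {π ρ} → π ≈ ρ → f π ≡ f ρ) →
                  ∃[ π ] (∀ ρ → f π ≤ f ρ)
min-Permutation zero    f f-cong = id , λ ρ → ≤-reflexive (f-cong λ ())
min-Permutation (suc n) f f-cong = insert zero j (best j) , λ ρ →
  ≤-trans (j-least (ρ ⟨$⟩ʳ zero))
  (≤-trans (best-least (ρ ⟨$⟩ʳ zero) (remove zero ρ))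
           (≤-reflexive (f-cong (insert-remove zero ρ))))
  where
  restricted : ∀ j → ∃[ π ] (∀ ρ → f (insert zero j π) ≤ f (insert zero j ρ))
  restricted j = min-Permutation n (λ π → f (insert zero j π))
                   (λ {π} {ρ} π≈ρ → f-cong (insert-cong j {π} {ρ} π≈ρ))

  best : Fin (suc n) → Permutation′ n
  best j = proj₁ (restricted j)

  best-least : ∀ j ρ → f (insert zero j (best j)) ≤ f (insert zero j ρ)
  best-least j = proj₂ (restricted j)

  minimum : ∃[ j ] (∀ k → f (insert zero j (best j)) ≤ f (insert zero k (best k)))
  minimum = min-Fin n (λ j → f (insert zero j (best j)))

  j       = proj₁ minimum
  j-least = proj₂ minimum

min-Permutations : ∀ m n (f : (Fin m → Permutation′ n) → ℕ) →
                   (∀ {π ρ} → (∀ i → π i ≈ ρ i) → f π ≡ f ρ) →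
                   ∃[ π ] (∀ ρ → f π ≤ f ρ)
min-Permutations zero    n f f-cong = (λ ()) , λ ρ → ≤-reflexive (f-cong λ ())
min-Permutations (suc m) n f f-cong = cons first (rest first) , λ ρ →
  ≤-trans (first-least (ρ zero))
  (≤-trans (rest-least (ρ zero) (λ i → ρ (suc i)))
           (≤-reflexive (f-cong λ { zero _ → refl ; (suc i) _ → refl })))
  where
  cons : Permutation′ n → (Fin m → Permutation′ n) → Fin (suc m) → Permutation′ n
  cons σ π zero    = σ
  cons σ π (suc i) = π i

  restricted : ∀ σ → ∃[ π ] (∀ ρ → f (cons σ π) ≤ f (cons σ ρ))
  restricted σ = min-Permutations m n (λ π → f (cons σ π))
                   (λ π≈ρ → f-cong λ { zero _ → refl ; (suc i) → π≈ρ i })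

  rest : Permutation′ n → Fin m → Permutation′ n
  rest σ = proj₁ (restricted σ)

  rest-least : ∀ σ ρ → f (cons σ (rest σ)) ≤ f (cons σ ρ)
  rest-least σ = proj₂ (restricted σ)

  -- rest σ need not respect ≈, but the value it attains does.
  value-≤ : ∀ {σ τ} → σ ≈ τ → f (cons σ (rest σ)) ≤ f (cons τ (rest τ))
  value-≤ {σ} {τ} σ≈τ = ≤-trans (rest-least σ (rest τ))
    (≤-reflexive (f-cong λ { zero → σ≈τ ; (suc i) _ → refl }))

  minimum : ∃[ σ ] (∀ τ → f (cons σ (rest σ)) ≤ f (cons τ (rest τ)))
  minimum = min-Permutation n (λ σ → f (cons σ (rest σ)))
    (λ {σ} {τ} σ≈τ → ≤-antisym
      (value-≤ {σ} {τ} σ≈τ) (value-≤ {τ} {σ} (λ k → sym (σ≈τ k))))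

  first       = proj₁ minimum
  first-least = proj₂ minimum

max-cong : ∀ {n} {u v : Vector ℕ n} → (∀ j → u j ≡ v j) → max u ≡ max v
max-cong {zero}  u≗v = refl
max-cong {suc n} u≗v = cong₂ _⊔_ (u≗v zero) (max-cong (λ j → u≗v (suc j)))

module _ (I : Instance) where
  open Instance I

  K-cong : ∀ {π ρ : Schedule I} → (∀ i → π i ≈ ρ i) → K I π ≡ K I ρ
  K-cong π≈ρ = max-cong λ j → sum-cong-≗ λ i → sum-cong-≗ λ ℓ →
    cong₂ (λ x y → if does (toℕ x ≤? toℕ y) then p i ℓ else 0) (π≈ρ i ℓ) (π≈ρ i j)

  optimal : ∃[ π ] (∀ ρ → K I π ≤ K I ρ)
  optimal = min-Permutations days clients (K I) (λ {π} {ρ} → K-cong {π} {ρ})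

  K* : ℕ
  K* = K I (proj₁ optimal)

------------------------------------------------------------------------
-- Model of computation: structured programs for a random access machine
-- under the logarithmic cost criterion.  A state consists of arrays of
-- natural numbers; a program can only use the finitely many arrays it
-- names, while the indices into them are computed at run time.

State : Set
State = ℕ → ℕ → ℕ

infixl 6 _⊕_ _⊖_
infixl 7 _⊗_ _⊘_

data Expr : Set where
  const               : ℕ → Expr
  _[_]                : ℕ → Expr → Expr
  _⊕_ _⊖_ _⊗_ _⊘_     : Expr → Expr → Expr

infix  4 _[_]≔_
infixr 3 _⨾_

data Program : Set where
  skip            : Program
  _[_]≔_        : ℕ → Expr → Expr → Program
  _⨾_             : Program → Program → Program
  test_then_else_ : Expr → Program → Program → Program
  while_loop_     : Expr → Program → Program

-- Truncated division, with x / 0 = 0.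
quotient : ℕ → ℕ → ℕ
quotient x zero    = 0
quotient x (suc y) = x / suc y

⟦_⟧ : Expr → State → ℕ
⟦ const k ⟧ s = k
⟦ a [ e ] ⟧ s = s a (⟦ e ⟧ s)
⟦ e ⊕ f ⟧   s = ⟦ e ⟧ s + ⟦ f ⟧ s
⟦ e ⊖ f ⟧   s = ⟦ e ⟧ s ∸ ⟦ f ⟧ s
⟦ e ⊗ f ⟧   s = ⟦ e ⟧ s * ⟦ f ⟧ s
⟦ e ⊘ f ⟧   s = quotient (⟦ e ⟧ s) (⟦ f ⟧ s)

_[_,_↦_] : State → ℕ → ℕ → ℕ → State
(s [ a , x ↦ v ]) b y =
  if does (a ≟ b) then (if does (x ≟ y) then v else s b y) else s b y

-- The number of binary digits of x, where 0 has one digit.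
len : ℕ → ℕ
len x = suc ⌊log₂ x ⌋

-- Every node of an expression is charged for the digits of its value, so
-- an array access pays for both its index and the value read.
cost : Expr → State → ℕ
cost (const k) s = 1 + len k
cost (a [ e ]) s = 1 + len (⟦ a [ e ] ⟧ s) + cost e s
cost (e ⊕ f)   s = 1 + len (⟦ e ⊕ f ⟧ s) + (cost e s + cost f s)
cost (e ⊖ f)   s = 1 + len (⟦ e ⊖ f ⟧ s) + (cost e s + cost f s)
cost (e ⊗ f)   s = 1 + len (⟦ e ⊗ f ⟧ s) + (cost e s + cost f s)
cost (e ⊘ f)   s = 1 + len (⟦ e ⊘ f ⟧ s) + (cost e s + cost f s)

infix 2 ⟨_,_⟩⇓⟨_,_⟩

-- ⟨ c , s ⟩⇓⟨ s′ , t ⟩: program c, started in s, halts in s′ after time t.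
data ⟨_,_⟩⇓⟨_,_⟩ : Program → State → State → ℕ → Set where
  ⇓-skip   : ∀ {s} → ⟨ skip , s ⟩⇓⟨ s , 1 ⟩
  ⇓-assign : ∀ {a e f s} →
             ⟨ a [ e ]≔ f , s ⟩⇓⟨ s [ a , ⟦ e ⟧ s ↦ ⟦ f ⟧ s ] , 1 + (cost e s + cost f s) ⟩
  ⇓-seq    : ∀ {c d s s′ s″ t u} →
             ⟨ c , s ⟩⇓⟨ s′ , t ⟩ → ⟨ d , s′ ⟩⇓⟨ s″ , u ⟩ →
             ⟨ c ⨾ d , s ⟩⇓⟨ s″ , t + u ⟩
  ⇓-then   : ∀ {e c d s s′ t} → ⟦ e ⟧ s ≢ 0 →
             ⟨ c , s ⟩⇓⟨ s′ , t ⟩ →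
             ⟨ test e then c else d , s ⟩⇓⟨ s′ , 1 + (cost e s + t) ⟩
  ⇓-else   : ∀ {e c d s s′ t} → ⟦ e ⟧ s ≡ 0 →
             ⟨ d , s ⟩⇓⟨ s′ , t ⟩ →
             ⟨ test e then c else d , s ⟩⇓⟨ s′ , 1 + (cost e s + t) ⟩
  ⇓-loop   : ∀ {e c s s′ s″ t u} → ⟦ e ⟧ s ≢ 0 →
             ⟨ c , s ⟩⇓⟨ s′ , t ⟩ → ⟨ while e loop c , s′ ⟩⇓⟨ s″ , u ⟩ →
             ⟨ while e loop c , s ⟩⇓⟨ s″ , 1 + (cost e s + (t + u)) ⟩
  ⇓-exit   : ∀ {e c s} → ⟦ e ⟧ s ≡ 0 →
             ⟨ while e loop c , s ⟩⇓⟨ s , 1 + cost e s ⟩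

⇓-deterministic : ∀ {c s s₁ s₂ t₁ t₂} →
                  ⟨ c , s ⟩⇓⟨ s₁ , t₁ ⟩ → ⟨ c , s ⟩⇓⟨ s₂ , t₂ ⟩ → s₁ ≡ s₂ × t₁ ≡ t₂
⇓-deterministic ⇓-skip ⇓-skip = refl , refl
⇓-deterministic ⇓-assign ⇓-assign = refl , refl
⇓-deterministic (⇓-seq x y) (⇓-seq x′ y′)
  with refl , refl ← ⇓-deterministic x x′
  with refl , refl ← ⇓-deterministic y y′ = refl , refl
⇓-deterministic (⇓-then _ x) (⇓-then _ x′)
  with refl , refl ← ⇓-deterministic x x′ = refl , refl
⇓-deterministic (⇓-then p _) (⇓-else q _) = contradiction q p
⇓-deterministic (⇓-else p _) (⇓-then q _) = contradiction p q
⇓-deterministic (⇓-else _ x) (⇓-else _ x′)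
  with refl , refl ← ⇓-deterministic x x′ = refl , refl
⇓-deterministic (⇓-loop _ x y) (⇓-loop _ x′ y′)
  with refl , refl ← ⇓-deterministic x x′
  with refl , refl ← ⇓-deterministic y y′ = refl , refl
⇓-deterministic (⇓-loop p _ _) (⇓-exit q) = contradiction q p
⇓-deterministic (⇓-exit p) (⇓-loop q _ _) = contradiction p q
⇓-deterministic (⇓-exit _) (⇓-exit _) = refl , refl

------------------------------------------------------------------------
-- Input and output conventions

module _ (I : Instance) where
  open Instance I

  -- The matrix p in row-major order: row i, column j is at clients * i + j.
  entry : ∀ k → Dec (k < days * clients) → ℕ
  entry k (yes k<) = uncurry p (remQuot clients (fromℕ< k<))
  entry k (no  _)  = 0

  -- Array 0 holds the dimensions, array 1 the processing times.
  input : State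
  input 0 0 = clients
  input 0 1 = days
  input 1 k = entry k (k <? days * clients)
  input _ _ = 0

  -- The length of the binary encoding of the instance.
  size : ℕ
  size = len clients + len days + (∑[ i < days ] ∑[ j < clients ] len (p i j))

  -- Array 2 holds the positions, laid out like the processing times.
  Outputs : State → Schedule I → Set
  Outputs s π = ∀ i j → s 2 (toℕ (combine i j)) ≡ toℕ (π i ⟨$⟩ʳ j)

-- Let the jobs of a day be run by Smith's rule for weights w, ties being run in
-- both orders half of the time, and double all completion times to keep them
-- integral.  This minimises the w-weighted sum of completion times, so the w-weighted
-- average of the doubled totals is at most 2 K* for every w.  Repeating this with w_j the amount by which the accumulated total of
-- client j exceeds the sum of these averages (rounded up) is regret matching: the
-- sum of the w_j² grows by at most a constant per round, so after T rounds every
-- accumulated total is at most 2 K* T + O(√T), without any linear program.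
--
-- On each day the accumulated times satisfy T times Queyranne's parallel
-- inequalities.  Hence ordering the jobs by accumulated time completes job j no
-- later than n / (n + 1) times its accumulated time divided by T.  The factor
-- n / (n + 1) leaves room for the O(√T) error once T = 4n⁵.
{-# OPTIONS --safe #-}
module Submission where

open import Defs
open import Algebra.Bundles using (CommutativeSemiring)
open import Data.Bool.Base using (true; false; if_then_else_; T)
open import Data.Fin.Base using (Fin; zero; suc; toℕ; fromℕ<; remQuot; combine; punchOut)
open import Data.Fin.Permutation using (Permutation′; _⟨$⟩ʳ_; _⟨$⟩ˡ_; inverseˡ; permutation; id)
import Data.Fin.Properties as Fin
open import Data.Nat.Base
open import Data.Nat.Divisibility using (n∣m*n)
open import Data.Nat.DivMod
open import Data.Nat.Induction using (<-rec)
open import Data.Nat.Logarithm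
open import Data.Nat.Properties
open import Data.Nat.Tactic.RingSolver using (solve-∀)
open import Data.Product.Base using (∃-syntax; _×_; _,_; proj₁; proj₂; uncurry)
open import Data.Sum.Base using (inj₁; inj₂)
open import Data.Vec.Functional using (Vector)
open import Function.Base using (_∘_)
open import Relation.Binary.Definitions using (tri<; tri≈; tri>)
open import Relation.Binary.PropositionalEquality hiding ([_])
open import Relation.Nullary using (Dec; yes; no; does; contradiction)
open import Relation.Nullary.Decidable using (dec-true; dec-false)
open import Algebra.Properties.Semiring.Sum
  (CommutativeSemiring.semiring +-*-commutativeSemiring)
  using (sum-syntax; sum-cong-≗; ∑-distrib-+; ∑-comm; *-distribˡ-sum; *-distribʳ-sum)

-- Finite sums of natural numbers

-- The factor 2 has a single source. In any order, the completion times of a set of jobs, weighted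
-- by processing times, sum to at least half the square of the set's total processing time `Q`. In a
-- sorted order that prefix finishes exactly at `Q`, so sorting at most doubles fractional times.
-- Doubled times absorb this loss: the doubled accumulated time over `T` already bounds the integral
-- completion time. The sum of squares in the parallel inequality is at least `Q * Q / n` by
-- Cauchy's inequality; keeping it yields the n / (n + 1), without which the result would be 2 plus
-- an error. Splitting ties evenly makes an order a function on pairs whose two directions sum to 2.
-- Under logarithmic cost, polynomially many steps are not enough: the numbers must also stay short
-- through all rounds. Integer charges help here, since exact averages would bring in denominators
-- from every round.

∑-mono : ∀ {n} {f g : Vector ℕ n} → (∀ i → f i ≤ g i) → ∑[ i < n ] f i ≤ ∑[ i < n ] g i
∑-mono {zero}  f≤g = z≤n
∑-mono {suc n} f≤g = +-mono-≤ (f≤g zero) (∑-mono (f≤g ∘ suc))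

∑-const : ∀ n x → ∑[ i < n ] x ≡ n * x
∑-const zero    x = refl
∑-const (suc n) x = cong (x +_) (∑-const n x)

term≤∑ : ∀ {n} (f : Vector ℕ n) i → f i ≤ ∑[ j < n ] f j
term≤∑ f zero    = m≤m+n _ _
term≤∑ f (suc i) = ≤-trans (term≤∑ (f ∘ suc) i) (m≤n+m _ _)

∑-zero : ∀ {n} {f : Vector ℕ n} → (∀ i → f i ≡ 0) → ∑[ i < n ] f i ≡ 0
∑-zero {n} f≡0 = trans (sum-cong-≗ {n} f≡0) (trans (∑-const n 0) (*-zeroʳ n))

∑-bound : ∀ {n} {f : Vector ℕ n} {b} → (∀ i → f i ≤ b) → ∑[ i < n ] f i ≤ n * b
∑-bound {n} f≤b = ≤-trans (∑-mono {n} f≤b) (≤-reflexive (∑-const n _))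

∑-single : ∀ {n} (f : Vector ℕ n) j →
           ∑[ k < n ] (if does (k Fin.≟ j) then f k else 0) ≡ f j
∑-single {suc n} f zero    = trans (cong (f zero +_) (∑-zero {n} λ _ → refl)) (+-identityʳ _)
∑-single f (suc j) = ∑-single (f ∘ suc) j

half-≤ : ∀ {x y} → x + x ≤ y + y → x ≤ y
half-≤ {x} {y} le = ≮⇒≥ λ y<x → <⇒≱ (+-mono-< y<x y<x) le

∑∑-symmetrise : ∀ {n} (f : Fin n → Fin n → ℕ) →
  ∑[ j < n ] ∑[ k < n ] f k j + ∑[ j < n ] ∑[ k < n ] f k j
    ≡ ∑[ j < n ] ∑[ k < n ] (f k j + f j k)
∑∑-symmetrise {n} f = begin
  S + S                                           ≡⟨ cong (S +_) (∑-comm λ j k → f k j) ⟩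
  S + ∑[ j < n ] ∑[ k < n ] f j k                 ≡⟨ ∑-distrib-+ {n} _ _ ⟨
  ∑[ j < n ] (∑[ k < n ] f k j + ∑[ k < n ] f j k) ≡⟨ sum-cong-≗ {n} (λ j → ∑-distrib-+ (λ k → f k j) (f j)) ⟨
  ∑[ j < n ] ∑[ k < n ] (f k j + f j k)           ∎
  where
  open ≡-Reasoning
  S = ∑[ j < n ] ∑[ k < n ] f k j

-- Adding a double sum to its transpose groups the terms by pairs without splitting the index range
-- into `k < j` and `k > j`; the case `k = j` of the hypothesis covers the diagonal.
∑∑-mono-symmetric : ∀ {n} {f g : Fin n → Fin n → ℕ} →
  (∀ k j → f k j + f j k ≤ g k j + g j k) →
  ∑[ j < n ] ∑[ k < n ] f k j ≤ ∑[ j < n ] ∑[ k < n ] g k j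
∑∑-mono-symmetric {n} {f} {g} le = half-≤ (begin
  _                                      ≡⟨ ∑∑-symmetrise f ⟩
  ∑[ j < n ] ∑[ k < n ] (f k j + f j k)  ≤⟨ ∑-mono {n} (λ j → ∑-mono {n} λ k → le k j) ⟩
  ∑[ j < n ] ∑[ k < n ] (g k j + g j k)  ≡⟨ ∑∑-symmetrise g ⟨
  _                                      ∎)
  where open ≤-Reasoning

∑*∑ : ∀ {n} (f g : Vector ℕ n) →
      (∑[ j < n ] f j) * (∑[ k < n ] g k) ≡ ∑[ j < n ] ∑[ k < n ] (f j * g k)
∑*∑ {n} f g = trans (*-distribʳ-sum {n} _ f) (sum-cong-≗ {n} λ j → *-distribˡ-sum {n} (f j) g)

two-products≤ : ∀ x y → x * y + y * x ≤ x * x + y * y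
two-products≤ x y with ≤-total x y
... | inj₁ x≤y with d , refl ← m≤n⇒∃[o]m+o≡n x≤y =
  ≤-trans (m≤m+n _ (d * d)) (≤-reflexive (identity x d))
  where
  identity : ∀ x d → x * (x + d) + (x + d) * x + d * d ≡ x * x + (x + d) * (x + d)
  identity = solve-∀
... | inj₂ y≤x with d , refl ← m≤n⇒∃[o]m+o≡n y≤x =
  ≤-trans (m≤m+n _ (d * d)) (≤-reflexive (identity y d))
  where
  identity : ∀ y d → (y + d) * y + y * (y + d) + d * d ≡ (y + d) * (y + d) + y * y
  identity = solve-∀

-- The square expands into products over pairs, and each pair satisfies `2xy ≤ x² + y²`.
cauchy : ∀ {n} (q : Vector ℕ n) →
         (∑[ k < n ] q k) * (∑[ k < n ] q k) ≤ n * ∑[ k < n ] (q k * q k)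
cauchy {n} q = begin
  (∑[ k < n ] q k) * (∑[ k < n ] q k)       ≡⟨ ∑*∑ q q ⟩
  ∑[ j < n ] ∑[ k < n ] (q j * q k)         ≤⟨ ∑∑-mono-symmetric (λ k j →
                                                 two-products≤ (q j) (q k)) ⟩
  ∑[ j < n ] ∑[ k < n ] (q j * q j)         ≡⟨ ∑-comm {n} {n} (λ j k → q j * q j) ⟩
  ∑[ k < n ] ∑[ j < n ] (q j * q j)         ≡⟨ ∑-const n _ ⟩
  n * ∑[ k < n ] (q k * q k)                ∎
  where open ≤-Reasoning

-- Single machine completion times

-- Expressions of the machine have no comparison, only truncated arithmetic. With this encoding
-- `ltE` and `precE` evaluate to `lt` and `prec` by definition.
lt : ℕ → ℕ → ℕ
lt x y = 1 ∸ (1 ∸ (y ∸ x))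

lt-< : ∀ {x y} → x < y → lt x y ≡ 1
lt-< {x} {y} x<y with y ∸ x | m<n⇒0<n∸m x<y
... | suc d | _ = cong (λ z → 1 ∸ z) (0∸n≡0 d)

lt-≥ : ∀ {x y} → y ≤ x → lt x y ≡ 0
lt-≥ y≤x rewrite m≤n⇒m∸n≡0 y≤x = refl

lt≤1 : ∀ x y → lt x y ≤ 1
lt≤1 x y = m∸n≤m 1 (1 ∸ (y ∸ x))

-- Twice the fraction of the job with key x that is processed before the job
-- with key y, where jobs with equal keys are run in both orders half of the time.
prec : ℕ → ℕ → ℕ
prec x y = 1 + lt x y ∸ lt y x

prec-< : ∀ {x y} → x < y → prec x y ≡ 2
prec-< x<y = cong₂ (λ a b → 1 + a ∸ b) (lt-< x<y) (lt-≥ (<⇒≤ x<y))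

prec-> : ∀ {x y} → y < x → prec x y ≡ 0
prec-> y<x = cong₂ (λ a b → 1 + a ∸ b) (lt-≥ (<⇒≤ y<x)) (lt-< y<x)

prec-≡ : ∀ x → prec x x ≡ 1
prec-≡ x = cong₂ (λ a b → 1 + a ∸ b) (lt-≥ (≤-refl {x})) (lt-≥ (≤-refl {x}))

prec≤2 : ∀ x y → prec x y ≤ 2
prec≤2 x y = ≤-trans (m∸n≤m _ (lt y x)) (s≤s (lt≤1 x y))

prec-swap : ∀ x y → prec x y + prec y x ≡ 2
prec-swap x y with <-cmp x y
... | tri< x<y _ _  = cong₂ _+_ (prec-< x<y) (prec-> x<y)
... | tri≈ _ refl _ = cong₂ _+_ (prec-≡ x) (prec-≡ x)
... | tri> _ _ y<x  = cong₂ _+_ (prec-> y<x) (prec-< y<x)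

-- `prec` puts the whole weight 2 on the smaller of the two values; on a tie every split costs the
-- same. This is Smith's rule for one pair of jobs.
prec-min : ∀ x y {a b} → a + b ≡ 2 → prec x y * x + prec y x * y ≤ a * x + b * y
prec-min x y {a} {b} a+b≡2 with <-cmp x y
... | tri< x<y _ _ rewrite prec-< x<y | prec-> x<y = begin
  2 * x + 0 * y  ≡⟨ cong (λ z → z * x + 0) a+b≡2 ⟨
  (a + b) * x + 0 ≡⟨ +-identityʳ _ ⟩
  (a + b) * x    ≡⟨ *-distribʳ-+ x a b ⟩
  a * x + b * x  ≤⟨ +-monoʳ-≤ (a * x) (*-monoʳ-≤ b (<⇒≤ x<y)) ⟩
  a * x + b * y  ∎
  where open ≤-Reasoning
... | tri≈ _ refl _ rewrite prec-≡ x = ≤-reflexive (trans (identity x)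
        (trans (cong (_* x) (sym a+b≡2)) (*-distribʳ-+ x a b)))
  where
  identity : ∀ x → 1 * x + 1 * x ≡ 2 * x
  identity = solve-∀
... | tri> _ _ y<x rewrite prec-< y<x | prec-> y<x = begin
  0 * x + 2 * y  ≡⟨ cong (_* y) a+b≡2 ⟨
  (a + b) * y    ≡⟨ *-distribʳ-+ y a b ⟩
  a * y + b * y  ≤⟨ +-monoˡ-≤ (b * y) (*-monoʳ-≤ a (<⇒≤ y<x)) ⟩
  a * x + b * y  ∎
  where open ≤-Reasoning

-- Twice the completion time of job j, when job k precedes job j to the extent c k j / 2.
doubled : ∀ {n} → Vector ℕ n → (Fin n → Fin n → ℕ) → Vector ℕ n
doubled {n} p c j = p j + ∑[ k < n ] (c k j * p k)

-- Smith's rule: job k precedes job j if p k / w k < p j / w j.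
smith : ∀ {n} → Vector ℕ n → Vector ℕ n → Fin n → Fin n → ℕ
smith p w k j = prec (p k * w j) (p j * w k)

-- Separates the part independent of the order from a sum over pairs, so that minimising over orders
-- decouples into pairs.
doubled-weighted : ∀ {n} (p w : Vector ℕ n) c →
  ∑[ j < n ] (w j * doubled p c j)
    ≡ ∑[ j < n ] (w j * p j) + ∑[ j < n ] ∑[ k < n ] (c k j * (p k * w j))
doubled-weighted {n} p w c = begin
  ∑[ j < n ] (w j * (p j + ∑[ k < n ] (c k j * p k)))
    ≡⟨ sum-cong-≗ {n} (λ j → trans (*-distribˡ-+ (w j) (p j) _)
         (cong (w j * p j +_) (trans (*-distribˡ-sum {n} (w j) _)
           (sum-cong-≗ {n} λ k → rearrange (w j) (c k j) (p k))))) ⟩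
  ∑[ j < n ] (w j * p j + ∑[ k < n ] (c k j * (p k * w j)))
    ≡⟨ ∑-distrib-+ {n} _ _ ⟩
  ∑[ j < n ] (w j * p j) + ∑[ j < n ] ∑[ k < n ] (c k j * (p k * w j)) ∎
  where
  open ≡-Reasoning
  rearrange : ∀ x y z → x * (y * z) ≡ y * (z * x)
  rearrange = solve-∀

smith-optimal : ∀ {n} (p w : Vector ℕ n) {c : Fin n → Fin n → ℕ} →
  (∀ k j → c k j + c j k ≡ 2) →
  ∑[ j < n ] (w j * doubled p (smith p w) j) ≤ ∑[ j < n ] (w j * doubled p c j)
smith-optimal p w {c} c-swap = begin
  _ ≡⟨ doubled-weighted p w (smith p w) ⟩
  _ ≤⟨ +-monoʳ-≤ _ (∑∑-mono-symmetric λ k j → prec-min (p k * w j) (p j * w k) {c k j} {c j k} (c-swap k j)) ⟩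
  _ ≡⟨ doubled-weighted p w c ⟨
  _ ∎
  where open ≤-Reasoning

-- Queyranne's parallel inequality for the set of jobs selected by q.
parallel-inequality : ∀ {n} (p q : Vector ℕ n) {c : Fin n → Fin n → ℕ} →
  (∀ k j → c k j + c j k ≡ 2) → (∀ j → q j ≤ p j) →
  ∑[ j < n ] (q j * q j) + (∑[ j < n ] q j) * (∑[ j < n ] q j)
    ≤ ∑[ j < n ] (q j * doubled p c j)
parallel-inequality {n} p q {c} c-swap q≤p = begin
  ∑[ j < n ] (q j * q j) + (∑[ j < n ] q j) * (∑[ j < n ] q j)
    ≡⟨ cong (∑[ j < n ] (q j * q j) +_) (∑*∑ q q) ⟩
  ∑[ j < n ] (q j * q j) + ∑[ j < n ] ∑[ k < n ] (q j * q k)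
    -- However `c` orders a pair, its two directions share the weight 2. For jobs of lengths `q` the
    -- inequality is thus an equality; only lengthening them to `p` loses anything.
    ≤⟨ +-monoʳ-≤ _ (∑∑-mono-symmetric λ k j → ≤-reflexive (pair k j)) ⟩
  ∑[ j < n ] (q j * q j) + ∑[ j < n ] ∑[ k < n ] (c k j * (q k * q j))
    ≡⟨ doubled-weighted q q c ⟨
  ∑[ j < n ] (q j * doubled q c j)
    ≤⟨ ∑-mono {n} (λ j → *-monoʳ-≤ (q j) (+-mono-≤ (q≤p j) (∑-mono {n} λ k → *-monoʳ-≤ (c k j) (q≤p k)))) ⟩
  ∑[ j < n ] (q j * doubled p c j) ∎
  where
  open ≤-Reasoning
  collect : ∀ a b x y → a * (x * y) + b * (y * x) ≡ (a + b) * (x * y)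
  collect = solve-∀
  twice : ∀ x y → y * x + x * y ≡ 2 * (x * y)
  twice = solve-∀
  pair : ∀ k j → q j * q k + q k * q j ≡ c k j * (q k * q j) + c j k * (q j * q k)
  pair k j = trans (twice (q k) (q j))
    (trans (cong (_* (q k * q j)) (sym (c-swap k j)))
           (sym (collect (c k j) (c j k) (q k) (q j))))

-- completionTime of Defs, for a single day with positions pos
completion : ∀ {n} → Vector ℕ n → Vector ℕ n → Vector ℕ n
completion {n} p pos j = ∑[ k < n ] (if does (pos k ≤? pos j) then p k else 0)

-- Makes an actual schedule a competitor of Smith's rule. Positions are distinct, so the only tie is
-- `k = j`; it contributes `p j` once, and the separate summand supplies the second copy.
doubled≤completion : ∀ {n} (p : Vector ℕ n) (π : Permutation′ n) j →
  let pos k = toℕ (π ⟨$⟩ʳ k) in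
  doubled p (λ k j → prec (pos k) (pos j)) j ≤ 2 * completion p pos j
doubled≤completion {n} p π j = begin
  p j + ∑[ k < n ] (prec (pos k) (pos j) * p k)
    ≡⟨ cong (_+ ∑[ k < n ] (prec (pos k) (pos j) * p k)) (∑-single p j) ⟨
  ∑[ k < n ] (if does (k Fin.≟ j) then p k else 0) + ∑[ k < n ] (prec (pos k) (pos j) * p k)
    ≡⟨ ∑-distrib-+ {n} _ _ ⟨
  ∑[ k < n ] ((if does (k Fin.≟ j) then p k else 0) + prec (pos k) (pos j) * p k)
    ≤⟨ ∑-mono {n} term ⟩
  ∑[ k < n ] (2 * (if does (pos k ≤? pos j) then p k else 0))
    ≡⟨ *-distribˡ-sum {n} 2 _ ⟨
  2 * completion p pos j ∎
  where
  open ≤-Reasoning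
  pos : Vector ℕ n
  pos k = toℕ (π ⟨$⟩ʳ k)
  term : ∀ k → (if does (k Fin.≟ j) then p k else 0) + prec (pos k) (pos j) * p k
             ≤ 2 * (if does (pos k ≤? pos j) then p k else 0)
  term k with k Fin.≟ j
  ... | yes refl rewrite prec-≡ (pos k) | dec-true (pos k ≤? pos k) ≤-refl = ≤-refl
  ... | no k≢j with <-cmp (pos k) (pos j)
  ...   | tri< lt _ _ rewrite prec-< lt | dec-true (pos k ≤? pos j) (<⇒≤ lt) = ≤-refl
  ...   | tri≈ _ eq _ = contradiction
            (trans (sym (inverseˡ π)) (trans (cong (π ⟨$⟩ˡ_) (Fin.toℕ-injective eq)) (inverseˡ π))) k≢j
  ...   | tri> _ _ gt rewrite prec-> gt = z≤n

-- Rounding an accumulated fractional schedule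

x*x≤y*y⇒x≤y : ∀ {x y} → x * x ≤ y * y → x ≤ y
x*x≤y*y⇒x≤y le = ≮⇒≥ λ y<x → <⇒≱ (*-mono-< y<x y<x) le

-- Let `q` select the jobs up to `j`, so that their total `Q` is the completion time of `j`.
-- Monotonicity bounds the right side of the parallel inequality by `Q * D j`, Cauchy bounds the sum
-- of squares below by `Q * Q / n`, and one factor `Q` cancels. The case `Q = 0` is trivial.
completion-bound : ∀ {n} (p D pos : Vector ℕ n) {t} →
  (∀ (q : Vector ℕ n) → (∀ k → q k ≤ p k) →
     t * (∑[ k < n ] (q k * q k) + (∑[ k < n ] q k) * (∑[ k < n ] q k))
       ≤ ∑[ k < n ] (q k * D k)) →
  (∀ k j → pos k ≤ pos j → D k ≤ D j) →
  ∀ j → t * (suc n * completion p pos j) ≤ n * D j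
completion-bound {n} p D pos {t} parallel monotone j with completion p pos j in eq
... | zero rewrite *-zeroʳ n | *-zeroʳ t = z≤n
... | Q@(suc _) = *-cancelʳ-≤ _ _ Q (begin
  t * (suc n * Q) * Q           ≡⟨ expand t n Q ⟩
  t * (Q * Q + n * (Q * Q))     ≤⟨ *-monoʳ-≤ t (+-monoˡ-≤ (n * (Q * Q)) Q*Q≤) ⟩
  t * (n * X + n * (Q * Q))     ≡⟨ collect t n X (Q * Q) ⟩
  n * (t * (X + Q * Q))         ≤⟨ *-monoʳ-≤ n t*≤ ⟩
  n * (∑[ k < n ] (q k * D k))  ≤⟨ *-monoʳ-≤ n (∑-mono {n} q*D≤) ⟩
  n * (∑[ k < n ] (q k * D j))  ≡⟨ cong (n *_) (*-distribʳ-sum {n} (D j) q) ⟨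
  n * (∑[ k < n ] q k * D j)    ≡⟨ cong (λ z → n * (z * D j)) eq ⟩
  n * (Q * D j)                 ≡⟨ swap n Q (D j) ⟩
  n * D j * Q                   ∎)
  where
  open ≤-Reasoning
  expand : ∀ t n Q → t * (suc n * Q) * Q ≡ t * (Q * Q + n * (Q * Q))
  expand = solve-∀
  collect : ∀ t n X Y → t * (n * X + n * Y) ≡ n * (t * (X + Y))
  collect = solve-∀
  swap : ∀ x y z → x * (y * z) ≡ x * z * y
  swap = solve-∀
  q : Vector ℕ n
  q k = if does (pos k ≤? pos j) then p k else 0
  X = ∑[ k < n ] (q k * q k)
  Q*Q≤ : Q * Q ≤ n * X
  Q*Q≤ = subst (λ z → z * z ≤ n * X) eq (cauchy q)
  q≤p : ∀ k → q k ≤ p k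
  q≤p k with does (pos k ≤? pos j)
  ... | true  = ≤-refl
  ... | false = z≤n
  t*≤ : t * (X + Q * Q) ≤ ∑[ k < n ] (q k * D k)
  t*≤ = subst (λ z → t * (X + z * z) ≤ ∑[ k < n ] (q k * D k)) eq (parallel q q≤p)
  q*D≤ : ∀ k → q k * D k ≤ q k * D j
  q*D≤ k with pos k ≤ᵇ pos j in k≤j
  ... | true  = *-monoʳ-≤ (p k) (monotone k j (≤ᵇ⇒≤ _ _ (subst T (sym k≤j) _)))
  ... | false = z≤n

-- The quotient is the ceiling of `x / w`. Since `b` is an integer, rounding up does not cross it:
-- the charge still respects the integral bound on the average.
ceil-≤ : ∀ x w {b} → x ≤ b * w → quotient (x + (w ∸ 1)) w ≤ b
ceil-≤ x zero    x≤ = z≤n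
ceil-≤ x (suc w) {b} x≤ = ≤-pred (m<n*o⇒m/o<n (begin-strict
  x + w              ≤⟨ +-monoˡ-≤ w x≤ ⟩
  b * suc w + w      <⟨ +-monoʳ-< (b * suc w) ≤-refl ⟩
  b * suc w + suc w  ≡⟨ +-comm (b * suc w) (suc w) ⟩
  suc b * suc w      ∎))
  where open ≤-Reasoning

≤-ceil : ∀ x w → (w ≡ 0 → x ≡ 0) → x ≤ quotient (x + (w ∸ 1)) w * w
≤-ceil x zero    x≡0 = ≤-reflexive (x≡0 refl)
≤-ceil x (suc w) _ = +-cancelʳ-≤ w x _ (begin
  x + w                                       ≡⟨ m≡m%n+[m/n]*n (x + w) (suc w) ⟩
  (x + w) % suc w + (x + w) / suc w * suc w   ≤⟨ +-monoˡ-≤ _ (≤-pred (m%n<n (x + w) (suc w))) ⟩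
  w + (x + w) / suc w * suc w                 ≡⟨ +-comm w _ ⟩
  (x + w) / suc w * suc w + w                 ∎)
  where open ≤-Reasoning

-- The expansion of `(w - e)²` with the negative term moved to the left. Truncation turns the
-- equality into an inequality, which for `w ≤ e` is `2we ≤ w² + e²`.
truncated-square : ∀ w e → (w ∸ e) * (w ∸ e) + 2 * (w * e) ≤ w * w + e * e
truncated-square w e with ≤-total w e
... | inj₁ w≤e rewrite m≤n⇒m∸n≡0 w≤e =
  ≤-trans (≤-reflexive (twice w e)) (two-products≤ w e)
  where
  twice : ∀ w e → 2 * (w * e) ≡ w * e + e * w
  twice = solve-∀
... | inj₂ e≤w with d , refl ← m≤n⇒∃[o]m+o≡n e≤w rewrite m+n∸m≡n e d =
  ≤-reflexive (identity d e)
  where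
  identity : ∀ d e → d * d + 2 * ((e + d) * e) ≡ (e + d) * (e + d) + e * e
  identity = solve-∀

-- (w + (v - a))² ≤ w² + 2w(v - a) + M² survives truncation of the regrets at 0.
regret-square : ∀ S A v a {M} → v ≤ M → a ≤ M →
  let w = S ∸ A ; w′ = (S + v) ∸ (A + a) in
  w′ * w′ + 2 * (w * a) ≤ w * w + 2 * (w * v) + M * M
regret-square S A v a {M} v≤M a≤M with ≤-total a v
... | inj₁ a≤v with e , refl ← m≤n⇒∃[o]m+o≡n a≤v = begin
  w′ * w′ + 2 * (w * a)            ≤⟨ +-monoˡ-≤ _ (*-mono-≤ w′≤ w′≤) ⟩
  (w + e) * (w + e) + 2 * (w * a)  ≡⟨ identity w e a ⟩
  w * w + 2 * (w * (a + e)) + e * e ≤⟨ +-monoʳ-≤ _ (*-mono-≤ e≤M e≤M) ⟩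
  w * w + 2 * (w * (a + e)) + M * M ∎
  where
  open ≤-Reasoning
  w = S ∸ A
  w′ = (S + (a + e)) ∸ (A + a)
  e≤M : e ≤ M
  e≤M = ≤-trans (m≤n+m e a) v≤M
  regroup : ∀ A a w e → A + w + (a + e) ≡ A + a + (w + e)
  regroup = solve-∀
  w′≤ : w′ ≤ w + e
  w′≤ = m≤n+o⇒m∸n≤o (S + (a + e)) (A + a) (≤-trans (+-monoˡ-≤ (a + e) (m≤n+m∸n S A))
          (≤-reflexive (regroup A a w e)))
  identity : ∀ w e a → (w + e) * (w + e) + 2 * (w * a) ≡ w * w + 2 * (w * (a + e)) + e * e
  identity = solve-∀
... | inj₂ v≤a with e , refl ← m≤n⇒∃[o]m+o≡n v≤a = begin
  w′ * w′ + 2 * (w * (v + e))                        ≤⟨ +-monoˡ-≤ _ (*-mono-≤ w′≤ w′≤) ⟩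
  (w ∸ e) * (w ∸ e) + 2 * (w * (v + e))              ≡⟨ regroup ((w ∸ e) * (w ∸ e)) w v e ⟩
  (w ∸ e) * (w ∸ e) + 2 * (w * e) + 2 * (w * v)      ≤⟨ +-monoˡ-≤ _ (truncated-square w e) ⟩
  w * w + e * e + 2 * (w * v)                        ≤⟨ +-monoˡ-≤ _ (+-monoʳ-≤ (w * w) (*-mono-≤ e≤M e≤M)) ⟩
  w * w + M * M + 2 * (w * v)                        ≡⟨ swap (w * w) (M * M) (2 * (w * v)) ⟩
  w * w + 2 * (w * v) + M * M                        ∎
  where
  open ≤-Reasoning
  w = S ∸ A
  w′ = (S + v) ∸ (A + (v + e))
  e≤M : e ≤ M
  e≤M = ≤-trans (m≤n+m e v) a≤M
  swap : ∀ x y z → x + y + z ≡ x + z + y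
  swap = solve-∀
  regroup : ∀ x w v e → x + 2 * (w * (v + e)) ≡ x + 2 * (w * e) + 2 * (w * v)
  regroup = solve-∀
  shift : ∀ A v e → A + (v + e) ≡ v + (A + e)
  shift = solve-∀
  w′≤ : w′ ≤ w ∸ e
  w′≤ = ≤-reflexive (trans (cong₂ _∸_ (+-comm S v) (shift A v e))
          (trans ([m+n]∸[m+o]≡n∸o v S (A + e)) (sym (∸-+-assoc S A e))))

-- The algorithm

module _ {m n : ℕ} (p : Fin m → Vector ℕ n) where

  times : Vector ℕ n → Fin m → Vector ℕ n
  times w i = doubled (p i) (smith (p i) w)

  totals : Vector ℕ n → Vector ℕ n
  totals w j = ∑[ i < m ] times w i j

  -- The weighted average of the totals, rounded up; 0 if all weights are 0.
  charge : Vector ℕ n → ℕ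
  charge w = quotient (∑[ j < n ] (w j * totals w j) + (∑[ j < n ] w j ∸ 1)) (∑[ j < n ] w j)

  -- Round `t` runs Smith's rule with weights `regret t`. Initially all weights are 0, so all pairs
  -- are ties. Truncation gives weight 0 to clients whose total does not exceed the charge.
  accumulated : ℕ → Fin m → Vector ℕ n
  charged     : ℕ → ℕ
  regret      : ℕ → Vector ℕ n

  accumulated zero    i j = 0
  accumulated (suc t) i j = accumulated t i j + times (regret t) i j
  charged zero    = 0
  charged (suc t) = charged t + charge (regret t)
  regret t j = ∑[ i < m ] accumulated t i j ∸ charged t

  private
    M = 3 * ∑[ i < m ] ∑[ j < n ] p i j

  -- A job's own time counts once separately and every job counts at most twice, hence the 3.
  times≤ : ∀ w i j → times w i j ≤ 3 * ∑[ k < n ] p i k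
  times≤ w i j = +-mono-≤ (term≤∑ (p i) j) (begin
    ∑[ k < n ] (smith (p i) w k j * p i k)
      ≤⟨ ∑-mono {n} (λ k → *-monoˡ-≤ (p i k) (prec≤2 (p i k * w j) (p i j * w k))) ⟩
    ∑[ k < n ] (2 * p i k)
      ≡⟨ *-distribˡ-sum {n} 2 (p i) ⟨
    2 * ∑[ k < n ] p i k ∎)
    where open ≤-Reasoning

  totals≤ : ∀ w j → totals w j ≤ M
  totals≤ w j = ≤-trans (∑-mono {m} λ i → times≤ w i j)
    (≤-reflexive (sym (*-distribˡ-sum {m} 3 (λ i → ∑[ j < n ] p i j))))

  charge-≤ : ∀ w {b} → ∑[ j < n ] (w j * totals w j) ≤ b * ∑[ j < n ] w j → charge w ≤ b
  charge-≤ w = ceil-≤ _ (∑[ j < n ] w j)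

  ≤-charge : ∀ w → ∑[ j < n ] (w j * totals w j) ≤ charge w * ∑[ j < n ] w j
  ≤-charge w = ≤-ceil (∑[ j < n ] (w j * totals w j)) (∑[ j < n ] w j) λ ∑w≡0 →
    ∑-zero {n} λ j → cong (_* totals w j) (n≤0⇒n≡0 (≤-trans (term≤∑ w j) (≤-reflexive ∑w≡0)))

  weighted≤M : ∀ w → ∑[ j < n ] (w j * totals w j) ≤ M * ∑[ j < n ] w j
  weighted≤M w = begin
    ∑[ j < n ] (w j * totals w j)  ≤⟨ ∑-mono {n} (λ j → *-monoʳ-≤ (w j) (totals≤ w j)) ⟩
    ∑[ j < n ] (w j * M)           ≡⟨ *-distribʳ-sum {n} M w ⟨
    ∑[ j < n ] w j * M             ≡⟨ *-comm (∑[ j < n ] w j) M ⟩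
    M * ∑[ j < n ] w j             ∎
    where open ≤-Reasoning

  potential : ℕ → ℕ
  potential t = ∑[ j < n ] (regret t j * regret t j)

  -- Summing `regret-square` over the clients leaves the cross terms `2 w v` on the right and
  -- `2 w a` on the left. The charge `a` is at least the weighted average of the totals `v`, so the
  -- cross terms cancel and only `M * M` per client remains.
  potential-step : ∀ t → potential (suc t) ≤ potential t + n * (M * M)
  potential-step t = +-cancelʳ-≤ (2 * wv) _ _ (begin
    potential (suc t) + 2 * wv
      ≤⟨ +-monoʳ-≤ (potential (suc t)) (*-monoʳ-≤ 2 wv≤) ⟩
    potential (suc t) + 2 * (∑[ j < n ] (w j * a))
      ≡⟨ cong (potential (suc t) +_) (*-distribˡ-sum {n} 2 _) ⟩
    potential (suc t) + ∑[ j < n ] (2 * (w j * a))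
      ≡⟨ ∑-distrib-+ {n} _ _ ⟨
    ∑[ j < n ] (regret (suc t) j * regret (suc t) j + 2 * (w j * a))
      ≤⟨ ∑-mono {n} step ⟩
    ∑[ j < n ] (w j * w j + 2 * (w j * v j) + M * M)
      ≡⟨ ∑-distrib-+ {n} _ _ ⟩
    ∑[ j < n ] (w j * w j + 2 * (w j * v j)) + ∑[ j < n ] (M * M)
      ≡⟨ cong₂ _+_ (∑-distrib-+ {n} _ _) (∑-const n (M * M)) ⟩
    potential t + ∑[ j < n ] (2 * (w j * v j)) + n * (M * M)
      ≡⟨ cong (λ z → potential t + z + n * (M * M)) (*-distribˡ-sum {n} 2 (λ j → w j * v j)) ⟨
    potential t + 2 * wv + n * (M * M)
      ≡⟨ swap (potential t) (2 * wv) (n * (M * M)) ⟩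
    potential t + n * (M * M) + 2 * wv ∎)
    where
    open ≤-Reasoning
    w = regret t
    v = totals w
    a = charge w
    wv = ∑[ j < n ] (w j * v j)
    swap : ∀ x y z → x + y + z ≡ x + z + y
    swap = solve-∀
    wv≤ : wv ≤ ∑[ j < n ] (w j * a)
    wv≤ = ≤-trans (≤-charge w)
      (≤-reflexive (trans (*-comm a _) (*-distribʳ-sum {n} a w)))
    step : ∀ j → regret (suc t) j * regret (suc t) j + 2 * (w j * a)
               ≤ w j * w j + 2 * (w j * v j) + M * M
    step j = subst (λ S → (S ∸ charged (suc t)) * (S ∸ charged (suc t)) + 2 * (w j * a)
                          ≤ w j * w j + 2 * (w j * v j) + M * M)
      (sym (∑-distrib-+ {m} (λ i → accumulated t i j) (λ i → times w i j)))
      (regret-square (∑[ i < m ] accumulated t i j) (charged t) (v j) a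
        (totals≤ w j) (charge-≤ w (weighted≤M w)))

  potential≤ : ∀ t → potential t ≤ t * (n * (M * M))
  potential≤ zero    = ≤-reflexive (∑-zero {n} λ j →
    cong (λ z → z * z) (∑-zero {m} λ _ → refl))
  potential≤ (suc t) = begin
    potential (suc t)                  ≤⟨ potential-step t ⟩
    potential t + n * (M * M)          ≤⟨ +-monoˡ-≤ _ (potential≤ t) ⟩
    t * (n * (M * M)) + n * (M * M)    ≡⟨ +-comm (t * (n * (M * M))) _ ⟩
    suc t * (n * (M * M))              ∎
    where open ≤-Reasoning

  -- Applied with `b` twice the cost of a schedule for the approximation factor, and with `b = M` to
  -- bound the size of the numbers.
  charged≤ : ∀ {b} → (∀ w → ∑[ j < n ] (w j * totals w j) ≤ b * ∑[ j < n ] w j) →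
             ∀ t → charged t ≤ t * b
  charged≤ le zero    = z≤n
  charged≤ {b} le (suc t) = ≤-trans
    (+-mono-≤ (charged≤ le t) (charge-≤ (regret t) (le (regret t))))
    (≤-reflexive (+-comm (t * b) b))

  -- The left side of the parallel inequality does not depend on the order, so the inequalities of
  -- all rounds add up although each round uses other weights.
  parallel-accumulated : ∀ t i (q : Vector ℕ n) → (∀ k → q k ≤ p i k) →
    t * (∑[ k < n ] (q k * q k) + (∑[ k < n ] q k) * (∑[ k < n ] q k))
      ≤ ∑[ k < n ] (q k * accumulated t i k)
  parallel-accumulated zero    i q q≤p = z≤n
  parallel-accumulated (suc t) i q q≤p = begin
    X + t * X
      ≤⟨ +-mono-≤ (parallel-inequality (p i) q {smith (p i) (regret t)}
                     (λ k j → prec-swap (p i k * regret t j) (p i j * regret t k)) q≤p)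
                  (parallel-accumulated t i q q≤p) ⟩
    ∑[ k < n ] (q k * times (regret t) i k) + ∑[ k < n ] (q k * accumulated t i k)
      ≡⟨ +-comm (∑[ k < n ] (q k * times (regret t) i k)) _ ⟩
    ∑[ k < n ] (q k * accumulated t i k) + ∑[ k < n ] (q k * times (regret t) i k)
      ≡⟨ ∑-distrib-+ {n} _ _ ⟨
    ∑[ k < n ] (q k * accumulated t i k + q k * times (regret t) i k)
      ≡⟨ sum-cong-≗ {n} (λ k → *-distribˡ-+ (q k) (accumulated t i k) _) ⟨
    ∑[ k < n ] (q k * accumulated (suc t) i k) ∎
    where
    open ≤-Reasoning
    X = ∑[ k < n ] (q k * q k) + (∑[ k < n ] q k) * (∑[ k < n ] q k)

  accumulated≤ : ∀ t i j → accumulated t i j ≤ t * M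
  accumulated≤ zero    i j = z≤n
  accumulated≤ (suc t) i j = ≤-trans
    (+-mono-≤ (accumulated≤ t i j) (≤-trans (term≤∑ (λ i → times (regret t) i j) i) (totals≤ (regret t) j)))
    (≤-reflexive (+-comm (t * M) M))

-- By regret≤ the regrets are then at most 6n⁴K, and n times this error is less
-- than the slack 2K · rounds n that the factor n / (n + 1) of completion-bound leaves.
rounds : ℕ → ℕ
rounds n = 4 * (n * n * n * n * n)

term≤max : ∀ {n} (u : Vector ℕ n) j → u j ≤ max u
term≤max u zero    = m≤m⊔n _ _
term≤max u (suc j) = ≤-trans (term≤max (u ∘ suc) j) (m≤n⊔m (u zero) _)

max≤ : ∀ {n} (u : Vector ℕ n) {b} → (∀ j → u j ≤ b) → max u ≤ b
max≤ {zero}  u u≤b = z≤n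
max≤ {suc n} u u≤b = ⊔-lub (u≤b zero) (max≤ (u ∘ suc) (u≤b ∘ suc))

-- The approximation guarantee

module _ (I : Instance) where
  open Instance I renaming (clients to n; days to m)

  positions : Schedule I → Fin m → Vector ℕ n
  positions π i k = toℕ (π i ⟨$⟩ʳ k)

  -- The weights are the same on every day, so the optimality of Smith's rule on single days adds up
  -- over the horizon. On the side of `π` each total is then replaced by the maximum.
  weighted-totals≤ : ∀ (π : Schedule I) w →
    ∑[ j < n ] (w j * totals p w j) ≤ 2 * K I π * ∑[ j < n ] w j
  weighted-totals≤ π w = begin
    ∑[ j < n ] (w j * totals p w j)
      ≡⟨ sum-cong-≗ {n} (λ j → *-distribˡ-sum {m} (w j) _) ⟩
    ∑[ j < n ] ∑[ i < m ] (w j * times p w i j)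
      ≡⟨ ∑-comm {n} {m} (λ j i → w j * times p w i j) ⟩
    ∑[ i < m ] ∑[ j < n ] (w j * times p w i j)
      ≤⟨ ∑-mono {m} (λ i → smith-optimal (p i) w {λ k j → prec (positions π i k) (positions π i j)}
           (λ k j → prec-swap (positions π i k) (positions π i j))) ⟩
    ∑[ i < m ] ∑[ j < n ] (w j * doubled (p i) (λ k j → prec (positions π i k) (positions π i j)) j)
      ≤⟨ ∑-mono {m} (λ i → ∑-mono {n} λ j → *-monoʳ-≤ (w j) (doubled≤completion (p i) (π i) j)) ⟩
    ∑[ i < m ] ∑[ j < n ] (w j * (2 * completionTime I π i j))
      ≡⟨ ∑-comm {m} {n} (λ i j → w j * (2 * completionTime I π i j)) ⟩
    ∑[ j < n ] ∑[ i < m ] (w j * (2 * completionTime I π i j))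
      ≡⟨ sum-cong-≗ {n} (λ j → trans (cong (w j *_) (*-distribˡ-sum {m} 2 (λ i → completionTime I π i j)))
           (*-distribˡ-sum {m} (w j) _)) ⟨
    ∑[ j < n ] (w j * (2 * totalCompletionTime I π j))
      ≤⟨ ∑-mono {n} (λ j → *-monoʳ-≤ (w j) (*-monoʳ-≤ 2 (term≤max (totalCompletionTime I π) j))) ⟩
    ∑[ j < n ] (w j * (2 * K I π))
      ≡⟨ *-distribʳ-sum {n} (2 * K I π) w ⟨
    ∑[ j < n ] w j * (2 * K I π)
      ≡⟨ *-comm (∑[ j < n ] w j) _ ⟩
    2 * K I π * ∑[ j < n ] w j ∎
    where open ≤-Reasoning

  p≤completionTime : ∀ π i j → p i j ≤ completionTime I π i j
  p≤completionTime π i j = ≤-trans (≤-reflexive (sym own)) (term≤∑ term j)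
    where
    term : Vector ℕ n
    term k = if does (positions π i k ≤? positions π i j) then p i k else 0
    own : term j ≡ p i j
    own rewrite dec-true (positions π i j ≤? positions π i j) ≤-refl = refl

  -- Every client waits at least for its own jobs. This converts the regret error, which is
  -- proportional to the total processing time, into a multiple of `K`.
  volume≤ : ∀ π → ∑[ i < m ] ∑[ j < n ] p i j ≤ n * K I π
  volume≤ π = begin
    ∑[ i < m ] ∑[ j < n ] p i j        ≡⟨ ∑-comm {m} {n} p ⟩
    ∑[ j < n ] ∑[ i < m ] p i j        ≤⟨ ∑-bound {n} (λ j → ≤-trans
                                           (∑-mono {m} λ i → p≤completionTime π i j)
                                           (term≤max (totalCompletionTime I π) j)) ⟩
    n * K I π                          ∎
    where open ≤-Reasoning

  -- A single squared regret is at most the potential. The choice of `rounds` makes the potential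
  -- bound a perfect square, 4n⁵ · n · (3P)² = (6n³P)², so no root has to be estimated.
  regret≤ : ∀ π j → regret p (rounds n) j ≤ 6 * (n * n * n * n) * K I π
  regret≤ π j = begin
    w                              ≤⟨ x*x≤y*y⇒x≤y (begin
      w * w                                    ≤⟨ term≤∑ (λ j → regret p (rounds n) j * regret p (rounds n) j) j ⟩
      potential p (rounds n)                   ≤⟨ potential≤ p (rounds n) ⟩
      rounds n * (n * (3 * P * (3 * P)))       ≡⟨ square n P ⟩
      6 * (n * n * n) * P * (6 * (n * n * n) * P) ∎) ⟩
    6 * (n * n * n) * P            ≤⟨ *-monoʳ-≤ (6 * (n * n * n)) (volume≤ π) ⟩
    6 * (n * n * n) * (n * K I π)  ≡⟨ regroup n (K I π) ⟩
    6 * (n * n * n * n) * K I π    ∎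
    where
    open ≤-Reasoning
    w = regret p (rounds n) j
    P = ∑[ i < m ] ∑[ j < n ] p i j
    square : ∀ n P → 4 * (n * n * n * n * n) * (n * (3 * P * (3 * P)))
                   ≡ 6 * (n * n * n) * P * (6 * (n * n * n) * P)
    square = solve-∀
    regroup : ∀ n K → 6 * (n * n * n) * (n * K) ≡ 6 * (n * n * n * n) * K
    regroup = solve-∀

  two-approximation : (π : Schedule I) →
    (∀ i k j → positions π i k ≤ positions π i j →
       accumulated p (rounds n) i k ≤ accumulated p (rounds n) i j) →
    ∀ ρ → K I π ≤ 2 * K I ρ
  two-approximation π monotone ρ = max≤ (totalCompletionTime I π) bound
    where
    open ≤-Reasoning
    R = rounds n
    κ = K I ρ
    S : Vector ℕ n
    S j = ∑[ i < m ] accumulated p R i j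
    S≤ : ∀ j → S j ≤ R * (2 * κ) + 6 * (n * n * n * n) * κ
    S≤ j = ≤-trans (m≤n+m∸n (S j) (charged p R))
      (+-mono-≤ (charged≤ p (weighted-totals≤ ρ) R) (regret≤ ρ j))
    C≤S : ∀ j → R * (suc n * totalCompletionTime I π j) ≤ n * S j
    C≤S j = begin
      R * (suc n * totalCompletionTime I π j)
        ≡⟨ cong (R *_) (*-distribˡ-sum {m} (suc n) _) ⟩
      R * (∑[ i < m ] (suc n * completionTime I π i j))
        ≡⟨ *-distribˡ-sum {m} R _ ⟩
      ∑[ i < m ] (R * (suc n * completionTime I π i j))
        ≤⟨ ∑-mono {m} (λ i → completion-bound (p i) (accumulated p R i) (positions π i) {R}
             (parallel-accumulated p R i) (monotone i) j) ⟩
      ∑[ i < m ] (n * accumulated p R i j)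
        ≡⟨ *-distribˡ-sum {m} n _ ⟨
      n * S j ∎
    identity : ∀ n κ → n * (4 * (n * n * n * n * n) * (2 * κ) + 6 * (n * n * n * n) * κ)
                         + 2 * (n * n * n * n * n) * κ
                       ≡ 4 * (n * n * n * n * n) * (suc n * (2 * κ))
    identity = solve-∀
    scaled : ∀ j → R * (suc n * totalCompletionTime I π j) ≤ R * (suc n * (2 * κ))
    scaled j = begin
      R * (suc n * totalCompletionTime I π j)                   ≤⟨ C≤S j ⟩
      n * S j                                                   ≤⟨ *-monoʳ-≤ n (S≤ j) ⟩
      n * (R * (2 * κ) + 6 * (n * n * n * n) * κ)               ≤⟨ m≤m+n _ _ ⟩
      n * (R * (2 * κ) + 6 * (n * n * n * n) * κ) + 2 * (n * n * n * n * n) * κ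
                                                                ≡⟨ identity n κ ⟩
      R * (suc n * (2 * κ))                                     ∎
    -- The existence of a client excludes `n = 0`, where `rounds n` would be 0 and could not be
    -- cancelled.
    cancel : ∀ n → Fin n → ∀ {x y} → rounds n * (suc n * x) ≤ rounds n * (suc n * y) → x ≤ y
    cancel (suc n′) _ le = *-cancelˡ-≤ (suc (suc n′)) (*-cancelˡ-≤ (rounds (suc n′)) le)
    bound : ∀ j → totalCompletionTime I π j ≤ 2 * κ
    bound j = cancel n j (scaled j)

-- Sorting by rank

∑-mono-< : ∀ {n} {f g : Vector ℕ n} → (∀ i → f i ≤ g i) → ∀ j → f j < g j →
           ∑[ i < n ] f i < ∑[ i < n ] g i
∑-mono-< {suc n} f≤g zero    f<g = +-mono-<-≤ f<g (∑-mono {n} (f≤g ∘ suc))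
∑-mono-< {suc n} f≤g (suc j) f<g = +-mono-≤-< (f≤g zero) (∑-mono-< {n} (f≤g ∘ suc) j f<g)

-- Pigeonhole principle: if `y` were missed, punching it out of the codomain would give an injection
-- into a smaller set.
injective⇒surjective : ∀ {n} (f : Fin n → Fin n) → (∀ {x y} → f x ≡ f y → x ≡ y) →
                       ∀ y → ∃[ x ] f x ≡ y
injective⇒surjective {suc n} f inj y with Fin.any? (λ x → f x Fin.≟ y)
... | yes hit = hit
... | no miss = contradiction
        (λ {i} {j} eq → inj (Fin.punchOut-injective (avoids i) (avoids j) eq))
        (Fin.<⇒notInjective {f = λ x → punchOut (avoids x)} ≤-refl)
  where
  avoids : ∀ x → y ≢ f x
  avoids x y≡fx = miss (x , sym y≡fx)

injection⇒permutation : ∀ {n} (f : Fin n → Fin n) → (∀ {x y} → f x ≡ f y → x ≡ y) →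
                        ∃[ π ] (∀ x → π ⟨$⟩ʳ x ≡ f x)
injection⇒permutation f inj = permutation f (proj₁ ∘ onto) (proj₂ ∘ onto)
    (λ x → inj (proj₂ (onto (f x)))) , λ _ → refl
  where onto = injective⇒surjective f inj

-- Sorting by counting needs one independent sum per job, which is the shape of loop that `tabulate`
-- provides.
rank : ∀ {n} → Vector ℕ n → Vector ℕ n
rank {n} key j = ∑[ k < n ] lt (key k) (key j)

module _ {n} (key : Vector ℕ n) where

  lt-own : ∀ j → lt (key j) (key j) ≡ 0
  lt-own j = lt-≥ (≤-refl {key j})

  rank<n : ∀ j → rank key j < n
  rank<n j = subst (rank key j <_) (trans (∑-const n 1) (*-identityʳ n))
    (∑-mono-< {n} (λ k → lt≤1 (key k) (key j)) j (s≤s (≤-reflexive (lt-own j))))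

  lt-monoʳ : ∀ x {y z} → y ≤ z → lt x y ≤ lt x z
  lt-monoʳ x y≤z = ∸-monoʳ-≤ 1 (∸-monoʳ-≤ 1 (∸-monoˡ-≤ x y≤z))

  -- If `key j < key k`, then everything counted for `j` is counted for `k`, and `j` itself in
  -- addition.
  rank-reflects-≤ : ∀ k j → rank key k ≤ rank key j → key k ≤ key j
  rank-reflects-≤ k j le = ≮⇒≥ λ j<k → <⇒≱
    (∑-mono-< {n} (λ l → lt-monoʳ (key l) (<⇒≤ j<k)) j
      (subst₂ _<_ (sym (lt-own j)) (sym (lt-< j<k)) ≤-refl)) le

  rank-permutation : (∀ {k j} → key k ≡ key j → k ≡ j) →
                     ∃[ π ] (∀ j → toℕ (π ⟨$⟩ʳ j) ≡ rank key j)
  rank-permutation inj = proj₁ sorted , λ j →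
      trans (cong toℕ (proj₂ sorted j)) (Fin.toℕ-fromℕ< (rank<n j))
    where
    rank-injective : ∀ {k j} → fromℕ< (rank<n k) ≡ fromℕ< (rank<n j) → k ≡ j
    rank-injective {k} {j} eq = inj (≤-antisym (rank-reflects-≤ k j (≤-reflexive same))
                                               (rank-reflects-≤ j k (≤-reflexive (sym same))))
      where
      same : rank key k ≡ rank key j
      same = trans (sym (Fin.toℕ-fromℕ< (rank<n k))) (trans (cong toℕ eq) (Fin.toℕ-fromℕ< (rank<n j)))
    sorted = injection⇒permutation (λ j → fromℕ< (rank<n j)) rank-injective

-- Since `toℕ j < n`, this key is the lexicographic order by `D`, then by index. Ranks form a
-- permutation only for distinct keys.
tie-broken : ∀ {n} → Vector ℕ n → Vector ℕ n
tie-broken {n} D j = n * D j + toℕ j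

module _ {n} (D : Vector ℕ n) where

  tie-broken-≤ : ∀ k j → tie-broken D k ≤ tie-broken D j → D k ≤ D j
  tie-broken-≤ k j le = ≮⇒≥ λ Dj<Dk → <⇒≱ (begin-strict
    n * D j + toℕ j  <⟨ +-monoʳ-< (n * D j) (Fin.toℕ<n j) ⟩
    n * D j + n      ≡⟨ +-comm (n * D j) n ⟩
    n + n * D j      ≡⟨ *-suc n (D j) ⟨
    n * suc (D j)    ≤⟨ *-monoʳ-≤ n Dj<Dk ⟩
    n * D k          ≤⟨ m≤m+n _ _ ⟩
    n * D k + toℕ k  ∎) le
    where open ≤-Reasoning

  tie-broken-injective : ∀ {k j} → tie-broken D k ≡ tie-broken D j → k ≡ j
  tie-broken-injective {k} {j} eq = Fin.toℕ-injective (+-cancelˡ-≡ (n * D j) _ _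
    (subst (λ z → n * z + toℕ k ≡ n * D j + toℕ j) D≡ eq))
    where
    D≡ : D k ≡ D j
    D≡ = ≤-antisym (tie-broken-≤ k j (≤-reflexive eq)) (tie-broken-≤ j k (≤-reflexive (sym eq)))

sorted-2-approximation : ∀ I → let open Instance I in
  (s : Fin days → Vector ℕ clients) →
  (∀ i j → s i j ≡ rank (tie-broken (accumulated p (rounds clients) i)) j) →
  ∃[ π ] ((∀ i j → s i j ≡ toℕ (π i ⟨$⟩ʳ j)) × K I π ≤ 2 * K* I)
sorted-2-approximation I s s≡rank = π , (λ i j → trans (s≡rank i j) (sym (proj₂ (sorted i) j))) ,
  two-approximation I π monotone (proj₁ (optimal I))
  where
  open Instance I
  D = accumulated p (rounds clients)
  sorted : ∀ i → ∃[ π ] (∀ j → toℕ (π ⟨$⟩ʳ j) ≡ rank (tie-broken (D i)) j)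
  sorted i = rank-permutation (tie-broken (D i)) (tie-broken-injective (D i))
  π : Schedule I
  π i = proj₁ (sorted i)
  monotone : ∀ i k j → positions I π i k ≤ positions I π i j → D i k ≤ D i j
  monotone i k j le = tie-broken-≤ (D i) k j (rank-reflects-≤ (tie-broken (D i)) k j
    (subst₂ _≤_ (proj₂ (sorted i) k) (proj₂ (sorted i) j) le))

-- Running times of expressions

infix 4 _≐_

_≐_ : State → State → Set
S ≐ S′ = ∀ a i → S a i ≡ S′ a i

⟦⟧-cong : ∀ e {S S′} → S ≐ S′ → ⟦ e ⟧ S ≡ ⟦ e ⟧ S′
⟦⟧-cong (const k) eq = refl
⟦⟧-cong (a [ e ]) {S} eq = trans (cong (S a) (⟦⟧-cong e eq)) (eq a _)
⟦⟧-cong (e ⊕ f)   eq = cong₂ _+_ (⟦⟧-cong e eq) (⟦⟧-cong f eq)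
⟦⟧-cong (e ⊖ f)   eq = cong₂ _∸_ (⟦⟧-cong e eq) (⟦⟧-cong f eq)
⟦⟧-cong (e ⊗ f)   eq = cong₂ _*_ (⟦⟧-cong e eq) (⟦⟧-cong f eq)
⟦⟧-cong (e ⊘ f)   eq = cong₂ quotient (⟦⟧-cong e eq) (⟦⟧-cong f eq)

cost-cong : ∀ e {S S′} → S ≐ S′ → cost e S ≡ cost e S′
cost-cong (const k)   eq = refl
cost-cong e@(_ [ i ]) eq = cong₂ (λ v c → 1 + len v + c) (⟦⟧-cong e eq) (cost-cong i eq)
cost-cong h@(e ⊕ f)   eq = cong₂ (λ v c → 1 + len v + c) (⟦⟧-cong h eq) (cong₂ _+_ (cost-cong e eq) (cost-cong f eq))
cost-cong h@(e ⊖ f)   eq = cong₂ (λ v c → 1 + len v + c) (⟦⟧-cong h eq) (cong₂ _+_ (cost-cong e eq) (cost-cong f eq))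
cost-cong h@(e ⊗ f)   eq = cong₂ (λ v c → 1 + len v + c) (⟦⟧-cong h eq) (cong₂ _+_ (cost-cong e eq) (cost-cong f eq))
cost-cong h@(e ⊘ f)   eq = cong₂ (λ v c → 1 + len v + c) (⟦⟧-cong h eq) (cong₂ _+_ (cost-cong e eq) (cost-cong f eq))

Bounded : ℕ → State → Set
Bounded B S = ∀ a i → S a i ≤ 2 ^ B

-- In a state bounded by `2 ^ B`, the value of `e` is at most `2 ^ (digitFactor e * suc B)` and its
-- cost at most `costFactor e * suc B`. Both factors depend on the program text only, so they are
-- constants of the algorithm; they are deliberately crude, with one rule for all operators.
digitFactor : Expr → ℕ
digitFactor (const k) = k
digitFactor (a [ e ]) = 1
digitFactor (e ⊕ f)   = 1 + (digitFactor e + digitFactor f)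
digitFactor (e ⊖ f)   = 1 + (digitFactor e + digitFactor f)
digitFactor (e ⊗ f)   = 1 + (digitFactor e + digitFactor f)
digitFactor (e ⊘ f)   = 1 + (digitFactor e + digitFactor f)

subcosts : Expr → ℕ
costFactor : Expr → ℕ
costFactor e = 2 + digitFactor e + subcosts e
subcosts (const k) = 0
subcosts (a [ e ]) = costFactor e
subcosts (e ⊕ f)   = costFactor e + costFactor f
subcosts (e ⊖ f)   = costFactor e + costFactor f
subcosts (e ⊗ f)   = costFactor e + costFactor f
subcosts (e ⊘ f)   = costFactor e + costFactor f

k≤2^k : ∀ k → k ≤ 2 ^ k
k≤2^k zero    = z≤n
k≤2^k (suc k) = begin
  1 + k               ≤⟨ +-mono-≤ (m^n>0 2 k) (k≤2^k k) ⟩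
  2 ^ k + 2 ^ k       ≡⟨ cong (2 ^ k +_) (+-identityʳ (2 ^ k)) ⟨
  2 ^ suc k           ∎
  where open ≤-Reasoning

+≤2^ : ∀ {x y a b} → x ≤ 2 ^ a → y ≤ 2 ^ b → x + y ≤ 2 ^ suc (a + b)
+≤2^ {x} {y} {a} {b} x≤ y≤ = begin
  x + y                        ≤⟨ +-mono-≤ (≤-trans x≤ (^-monoʳ-≤ 2 (m≤m+n a b)))
                                           (≤-trans y≤ (^-monoʳ-≤ 2 (m≤n+m b a))) ⟩
  2 ^ (a + b) + 2 ^ (a + b)    ≡⟨ cong (2 ^ (a + b) +_) (+-identityʳ (2 ^ (a + b))) ⟨
  2 ^ suc (a + b)              ∎
  where open ≤-Reasoning

*≤2^ : ∀ {x y a b} → x ≤ 2 ^ a → y ≤ 2 ^ b → x * y ≤ 2 ^ (a + b)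
*≤2^ {a = a} {b} x≤ y≤ = ≤-trans (*-mono-≤ x≤ y≤) (≤-reflexive (sym (^-distribˡ-+-* 2 a b)))

quotient≤ : ∀ x y → quotient x y ≤ x
quotient≤ x zero    = z≤n
quotient≤ x (suc y) = m/n≤m x (suc y)

len≤ : ∀ {x k} → x ≤ 2 ^ k → len x ≤ suc k
len≤ {x} {k} x≤ = s≤s (≤-trans (⌊log₂⌋-mono-≤ x≤) (≤-reflexive (⌊log₂[2^n]⌋≡n k)))

module _ {B S} (bounded : Bounded B S) where

  private
    node : ∀ b c {x y} → x ≤ 2 ^ (b * suc B) → y ≤ 2 ^ (c * suc B) →
           (x + y ≤ 2 ^ ((1 + (b + c)) * suc B)) × (x * y ≤ 2 ^ ((1 + (b + c)) * suc B))
    node b c x≤ y≤ =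
        ≤-trans (+≤2^ {a = b * suc B} {c * suc B} x≤ y≤) (^-monoʳ-≤ 2 (s≤s (≤-trans enough (m≤n+m _ B))))
      , ≤-trans (*≤2^ {a = b * suc B} {c * suc B} x≤ y≤) (^-monoʳ-≤ 2 (≤-trans enough (m≤n+m _ (suc B))))
      where
      enough : b * suc B + c * suc B ≤ (b + c) * suc B
      enough = ≤-reflexive (sym (*-distribʳ-+ (suc B) b c))

  value≤ : ∀ e → ⟦ e ⟧ S ≤ 2 ^ (digitFactor e * suc B)
  value≤ (const k) = ≤-trans (k≤2^k k) (^-monoʳ-≤ 2 (m≤m*n k (suc B)))
  value≤ (a [ e ]) = ≤-trans (bounded a _) (^-monoʳ-≤ 2 (≤-trans (n≤1+n B) (m≤m+n (suc B) 0)))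
  value≤ (e ⊕ f) = proj₁ (node (digitFactor e) (digitFactor f) (value≤ e) (value≤ f))
  value≤ (e ⊖ f) = ≤-trans (≤-trans (m∸n≤m (⟦ e ⟧ S) (⟦ f ⟧ S)) (m≤m+n _ _))
    (proj₁ (node (digitFactor e) (digitFactor f) (value≤ e) (value≤ f)))
  value≤ (e ⊗ f) = proj₂ (node (digitFactor e) (digitFactor f) (value≤ e) (value≤ f))
  value≤ (e ⊘ f) = ≤-trans (≤-trans (quotient≤ (⟦ e ⟧ S) (⟦ f ⟧ S)) (m≤m+n _ _))
    (proj₁ (node (digitFactor e) (digitFactor f) (value≤ e) (value≤ f)))

  private
    node-cost : ∀ e {c} → c ≤ subcosts e * suc B → 1 + len (⟦ e ⟧ S) + c ≤ costFactor e * suc B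
    node-cost e {c} c≤ = begin
      1 + len (⟦ e ⟧ S) + c
        ≤⟨ +-mono-≤ (s≤s (len≤ {k = digitFactor e * suc B} (value≤ e))) c≤ ⟩
      2 + digitFactor e * suc B + subcosts e * suc B
        ≤⟨ +-monoˡ-≤ (subcosts e * suc B) (+-monoˡ-≤ (digitFactor e * suc B) (m≤m*n 2 (suc B))) ⟩
      2 * suc B + digitFactor e * suc B + subcosts e * suc B
        ≡⟨ cong (_+ subcosts e * suc B) (*-distribʳ-+ (suc B) 2 (digitFactor e)) ⟨
      (2 + digitFactor e) * suc B + subcosts e * suc B
        ≡⟨ *-distribʳ-+ (suc B) (2 + digitFactor e) (subcosts e) ⟨
      costFactor e * suc B ∎
      where open ≤-Reasoning

  cost≤ : ∀ e → cost e S ≤ costFactor e * suc B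

  private
    two : ∀ e f → cost e S + cost f S ≤ (costFactor e + costFactor f) * suc B
    two e f = ≤-trans (+-mono-≤ (cost≤ e) (cost≤ f))
      (≤-reflexive (sym (*-distribʳ-+ (suc B) (costFactor e) (costFactor f))))

  cost≤ (const k)   = ≤-trans (≤-reflexive (sym (+-identityʳ (1 + len k)))) (node-cost (const k) z≤n)
  cost≤ h@(a [ e ]) = node-cost h (cost≤ e)
  cost≤ h@(e ⊕ f)   = node-cost h (two e f)
  cost≤ h@(e ⊖ f)   = node-cost h (two e f)
  cost≤ h@(e ⊗ f)   = node-cost h (two e f)
  cost≤ h@(e ⊘ f)   = node-cost h (two e f)

  unit-cost : ∀ e f → 1 + (cost e S + cost f S) ≤ (1 + (costFactor e + costFactor f)) * suc B
  unit-cost e f = +-mono-≤ (s≤s z≤n) (two e f)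

-- Executions up to pointwise equality of states

Runs : Program → State → State → ℕ → Set
Runs c S S′ τ = ∀ {s} → s ≐ S → ∃[ s′ ] ∃[ t ] (⟨ c , s ⟩⇓⟨ s′ , t ⟩ × s′ ≐ S′ × t ≤ τ)

runs-cong : ∀ {c S S₁ S′ S₁′ τ} → S₁ ≐ S → S′ ≐ S₁′ → Runs c S S′ τ → Runs c S₁ S₁′ τ
runs-cong before after run eq with s′ , t , exec , eq′ , t≤ ← run (λ a i → trans (eq a i) (before a i)) =
  s′ , t , exec , (λ a i → trans (eq′ a i) (after a i)) , t≤

runs-mono : ∀ {c S S′ τ υ} → τ ≤ υ → Runs c S S′ τ → Runs c S S′ υ
runs-mono τ≤υ run eq with s′ , t , exec , eq′ , t≤ ← run eq = s′ , t , exec , eq′ , ≤-trans t≤ τ≤υ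

update-cong : ∀ {S S′} → S ≐ S′ → ∀ a x v → S [ a , x ↦ v ] ≐ S′ [ a , x ↦ v ]
update-cong eq a x v b y with does (a ≟ b) | does (x ≟ y)
... | true  | true  = refl
... | true  | false = eq b y
... | false | _     = eq b y

runs-assign : ∀ {a e f S S′ u} → S [ a , ⟦ e ⟧ S ↦ ⟦ f ⟧ S ] ≐ S′ →
              1 + (cost e S + cost f S) ≤ u → Runs (a [ e ]≔ f) S S′ u
runs-assign {a} {e} {f} {S} after cost≤u {s} eq =
  _ , _ , ⇓-assign
    , (λ b y → trans (trans (cong₂ (λ x v → (s [ a , x ↦ v ]) b y) (⟦⟧-cong e eq) (⟦⟧-cong f eq))
                            (update-cong eq a (⟦ e ⟧ S) (⟦ f ⟧ S) b y)) (after b y))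
    , ≤-trans (≤-reflexive (cong (1 +_) (cong₂ _+_ (cost-cong e eq) (cost-cong f eq)))) cost≤u

runs-seq : ∀ {c d S S′ S″ τ υ} → Runs c S S′ τ → Runs d S′ S″ υ → Runs (c ⨾ d) S S″ (τ + υ)
runs-seq run run′ eq with _ , _ , exec , eq′ , t≤ ← run eq
  with _ , _ , exec′ , eq″ , u≤ ← run′ eq′ = _ , _ , ⇓-seq exec exec′ , eq″ , +-mono-≤ t≤ u≤

runs-loop : ∀ {e c S S′ S″ u τ υ} → ⟦ e ⟧ S ≢ 0 → 1 + cost e S ≤ u →
            Runs c S S′ τ → Runs (while e loop c) S′ S″ υ → Runs (while e loop c) S S″ (u + (τ + υ))
runs-loop {e} ≢0 cost≤u run run′ eq with _ , _ , exec , eq′ , t≤ ← run eq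
  with _ , _ , exec′ , eq″ , u≤ ← run′ eq′ =
  _ , _ , ⇓-loop (λ ≡0 → ≢0 (trans (sym (⟦⟧-cong e eq)) ≡0)) exec exec′ , eq″
    , +-mono-≤ (≤-trans (≤-reflexive (cong suc (cost-cong e eq))) cost≤u) (+-mono-≤ t≤ u≤)

runs-exit : ∀ {e c S u} → ⟦ e ⟧ S ≡ 0 → 1 + cost e S ≤ u → Runs (while e loop c) S S u
runs-exit {e} ≡0 cost≤u eq = _ , _ , ⇓-exit (trans (⟦⟧-cong e eq) ≡0) , eq
  , ≤-trans (≤-reflexive (cong suc (cost-cong e eq))) cost≤u

-- Tabulating an array of sums

infixl 6 _⟨_≔_⟩

_⟨_≔_⟩ : State → ℕ → (ℕ → ℕ) → State
(V ⟨ a ≔ g ⟩) b i = if does (a ≟ b) then g i else V b i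

-- Array 3 serves as the registers of the loops: cells 0 and 1 are loop
-- counters and cell 2 accumulates a sum.

registers : ℕ → ℕ → ℕ → ℕ → ℕ
registers x k c 0 = x
registers x k c 1 = k
registers x k c 2 = c
registers x k c _ = 0

withRegisters : State → ℕ → ℕ → ℕ → State
withRegisters V x k c = V ⟨ 3 ≔ registers x k c ⟩

index counter accumulator : Expr
index       = 3 [ const 0 ]
counter     = 3 [ const 1 ]
accumulator = 3 [ const 2 ]

sumLoop : Expr → Program
sumLoop e = while counter loop
  (3 [ const 1 ]≔ counter ⊖ const 1 ⨾ 3 [ const 2 ]≔ accumulator ⊕ e)

tabulateRow : ℕ → Expr → Expr → Expr → Program
tabulateRow a L e f =
  3 [ const 0 ]≔ index ⊖ const 1 ⨾
  3 [ const 1 ]≔ L ⨾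
  sumLoop e ⨾
  a [ index ]≔ f ⨾
  3 [ const 2 ]≔ const 0

-- For all x < N, cell x of array a is set to f, in which the accumulator
-- stands for the sum of e over all counters below L.
tabulate : ℕ → Expr → Expr → Expr → Expr → Program
tabulate a N L e f = 3 [ const 0 ]≔ N ⨾ while index loop tabulateRow a L e f

fill : ℕ → (ℕ → ℕ) → (ℕ → ℕ) → ℕ → ℕ
fill n F g i = if does (i <? n) then F i else g i

fill-< : ∀ {n} F g {i} → i < n → fill n F g i ≡ F i
fill-< {n} F g {i} i<n = cong (if_then F i else g i) (dec-true (i <? n) i<n)

fill-≥ : ∀ {n} F g {i} → n ≤ i → fill n F g i ≡ g i
fill-≥ {n} F g {i} n≤i = cong (if_then F i else g i) (dec-false (i <? n) (≤⇒≯ n≤i))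

fill-≤ : ∀ {n} F g {b} → (∀ i → i < n → F i ≤ b) → (∀ i → g i ≤ b) → ∀ i → fill n F g i ≤ b
fill-≤ {n} F g F≤ g≤ i with i <? n
... | yes i<n = ≤-trans (≤-reflexive (fill-< F g i<n)) (F≤ i i<n)
... | no  i≮n = ≤-trans (≤-reflexive (fill-≥ F g (≮⇒≥ i≮n))) (g≤ i)

-- The summation loop counts down and adds the last term first, whereas the sum peels off the first
-- term.
∑-last : ∀ k (g : ℕ → ℕ) → ∑[ i < suc k ] g (toℕ i) ≡ g k + ∑[ i < k ] g (toℕ i)
∑-last zero    g = refl
∑-last (suc k) g = begin
  g 0 + ∑[ i < suc k ] g (suc (toℕ i))           ≡⟨ cong (g 0 +_) (∑-last k (g ∘ suc)) ⟩
  g 0 + (g (suc k) + ∑[ i < k ] g (suc (toℕ i))) ≡⟨ exchange (g 0) (g (suc k)) _ ⟩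
  g (suc k) + (g 0 + ∑[ i < k ] g (suc (toℕ i))) ∎
  where
  open ≡-Reasoning
  exchange : ∀ x y z → x + (y + z) ≡ y + (x + z)
  exchange = solve-∀

set-cell : ∀ V a g {g′} x {v} → (∀ y → (if does (x ≟ y) then v else g y) ≡ g′ y) →
           (V ⟨ a ≔ g ⟩) [ a , x ↦ v ] ≐ V ⟨ a ≔ g′ ⟩
set-cell V a g x eq b y with a ≟ b
... | yes refl rewrite dec-true (a ≟ a) refl = eq y
... | no  a≢b  rewrite dec-false (a ≟ b) a≢b = refl

set-below : ∀ V a g {g′} x {v} r → a ≢ 3 → (∀ y → (if does (x ≟ y) then v else g y) ≡ g′ y) →
            (V ⟨ a ≔ g ⟩ ⟨ 3 ≔ r ⟩) [ a , x ↦ v ] ≐ V ⟨ a ≔ g′ ⟩ ⟨ 3 ≔ r ⟩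
set-below V a g x r a≢3 eq b y with a ≟ b
... | yes refl rewrite dec-true (a ≟ a) refl | dec-false (3 ≟ a) (a≢3 ∘ sym) = eq y
... | no  a≢b  rewrite dec-false (a ≟ b) a≢b = refl

set-≤ : ∀ {V a g b} → (∀ b′ i → V b′ i ≤ b) → (∀ i → g i ≤ b) → ∀ b′ i → (V ⟨ a ≔ g ⟩) b′ i ≤ b
set-≤ {a = a} V≤ g≤ b′ i with does (a ≟ b′)
... | true  = g≤ i
... | false = V≤ b′ i

registers-≤ : ∀ {x k c b} → x ≤ b → k ≤ b → c ≤ b → ∀ i → registers x k c i ≤ b
registers-≤ x≤ k≤ c≤ 0 = x≤
registers-≤ x≤ k≤ c≤ 1 = k≤
registers-≤ x≤ k≤ c≤ 2 = c≤
registers-≤ x≤ k≤ c≤ (suc (suc (suc _))) = z≤n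

set-index : ∀ V x k c x′ → (withRegisters V x k c) [ 3 , 0 ↦ x′ ] ≐ withRegisters V x′ k c
set-index V x k c x′ = set-cell V 3 (registers x k c) 0 λ { 0 → refl ; 1 → refl ; 2 → refl ; (suc (suc (suc _))) → refl }

set-counter : ∀ V x k c k′ → (withRegisters V x k c) [ 3 , 1 ↦ k′ ] ≐ withRegisters V x k′ c
set-counter V x k c k′ = set-cell V 3 (registers x k c) 1 λ { 0 → refl ; 1 → refl ; 2 → refl ; (suc (suc (suc _))) → refl }

set-accumulator : ∀ V x k c c′ → (withRegisters V x k c) [ 3 , 2 ↦ c′ ] ≐ withRegisters V x k c′
set-accumulator V x k c c′ = set-cell V 3 (registers x k c) 2 λ { 0 → refl ; 1 → refl ; 2 → refl ; (suc (suc (suc _))) → refl }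

opaque
  -- The 100 generously covers the register bookkeeping, whose largest demand is 18.
  tabulateFactor : Expr → Expr → Expr → Expr → ℕ
  tabulateFactor N L e f =
    100 + (costFactor N + (costFactor L + (costFactor (accumulator ⊕ e) + costFactor f)))

  tail≤factor : ∀ N L e f i {x} → i ≤ 100 →
    x ≤ costFactor N + (costFactor L + (costFactor (accumulator ⊕ e) + costFactor f)) →
    i + x ≤ tabulateFactor N L e f
  tail≤factor N L e f i = +-mono-≤

  literal≤factor : ∀ N L e f i → i ≤ 100 → i ≤ tabulateFactor N L e f
  literal≤factor N L e f i i≤ = ≤-trans i≤ (m≤m+n 100 _)

-- Array `a` is overwritten during the loop, so the hypotheses hold for every content `h` of it.
-- Thus `L` and `e` must not depend on that content, while `f` may use the cell about to be written,
-- which still has its old value. This permits updates in place.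
module _
  {B V} (bounded : Bounded B V) {a} (a≢3 : a ≢ 3) {N L e f : Expr} {n l : ℕ}
  {E : ℕ → ℕ → ℕ} {F : ℕ → ℕ → ℕ}
  (N≡ : ⟦ N ⟧ (withRegisters V 0 0 0) ≡ n)
  (L≡ : ∀ h x → x < n → ⟦ L ⟧ (withRegisters (V ⟨ a ≔ h ⟩) x 0 0) ≡ l)
  (e≡ : ∀ h x k c → x < n → k < l → ⟦ e ⟧ (withRegisters (V ⟨ a ≔ h ⟩) x k c) ≡ E x k)
  (f≡ : ∀ h x c → x < n → h x ≡ V a x → ⟦ f ⟧ (withRegisters (V ⟨ a ≔ h ⟩) x 0 c) ≡ F x c)
  (n≤ : n ≤ 2 ^ B) (l≤ : l ≤ 2 ^ B)
  (∑≤ : ∀ x → x < n → ∑[ k < l ] E x (toℕ k) ≤ 2 ^ B)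
  (F≤ : ∀ x → x < n → F x (∑[ k < l ] E x (toℕ k)) ≤ 2 ^ B)
  where

  private
    κ u : ℕ
    κ = tabulateFactor N L e f
    u = κ * suc B

    computed : ℕ → ℕ
    computed x = F x (∑[ k < l ] E x (toℕ k))

    state : (ℕ → ℕ) → ℕ → ℕ → ℕ → State
    state h = withRegisters (V ⟨ a ≔ h ⟩)

    state-bounded : ∀ {h x k c} → (∀ i → h i ≤ 2 ^ B) → x ≤ 2 ^ B → k ≤ 2 ^ B → c ≤ 2 ^ B →
                    Bounded B (state h x k c)
    state-bounded h≤ x≤ k≤ c≤ = set-≤ {a = 3} (set-≤ {a = a} bounded h≤) (registers-≤ x≤ k≤ c≤)

    factor : ∀ {S} → Bounded B S → ∀ i g → 1 + (costFactor i + costFactor g) ≤ κ →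
             1 + (cost i S + cost g S) ≤ u
    factor b i g le = ≤-trans (unit-cost b i g) (*-monoˡ-≤ (suc B) le)

    test-factor : ∀ {S} → Bounded B S → ∀ i → 1 + costFactor i ≤ κ → 1 + cost i S ≤ u
    test-factor b i le = ≤-trans (+-mono-≤ (s≤s z≤n) (cost≤ b i)) (*-monoˡ-≤ (suc B) le)

    tail≤κ = tail≤factor N L e f
    literal≤κ = literal≤factor N L e f

    sumLoop-runs : ∀ {h x} → (∀ i → h i ≤ 2 ^ B) → x < n → ∀ k c → k ≤ l →
      c + ∑[ j < k ] E x (toℕ j) ≤ 2 ^ B →
      Runs (sumLoop e) (state h x k c) (state h x 0 (c + ∑[ j < k ] E x (toℕ j))) ((1 + 3 * k) * u)
    sumLoop-runs {h} {x} h≤ x<n zero c k≤l ≤B =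
      runs-cong (λ _ _ → refl) (λ b i → cong (λ z → state h x 0 z b i) (sym (+-identityʳ c)))
        (runs-mono (≤-reflexive (sym (+-identityʳ u)))
          (runs-exit refl (test-factor (state-bounded h≤ (<⇒≤ (<-≤-trans x<n n≤)) z≤n
                                         (≤-trans (m≤m+n c 0) ≤B))
                            counter (literal≤κ 7 (m≤m+n 7 93)))))
    sumLoop-runs {h} {x} h≤ x<n (suc k) c k<l ≤B =
      runs-cong (λ _ _ → refl) (λ b i → cong (λ z → state h x 0 z b i) total)
        (runs-mono (≤-reflexive (time k u))
          (runs-loop {S = state h x (suc k) c} {S′ = state h x k (c + E x k)}
            (λ ()) (test-factor before counter (literal≤κ 7 (m≤m+n 7 93)))
            (runs-seq {S′ = state h x k c}
              (runs-assign (set-counter (V ⟨ a ≔ h ⟩) x (suc k) c k)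
                (factor before (const 1) (counter ⊖ const 1) (literal≤κ 18 (m≤m+n 18 82))))
              (runs-assign
                (λ b i → trans (cong (λ z → (state h x k c [ 3 , 2 ↦ c + z ]) b i) (e≡ h x k c x<n k<l))
                               (set-accumulator (V ⟨ a ≔ h ⟩) x k c (c + E x k) b i))
                (factor after (const 2) (accumulator ⊕ e)
                  (tail≤κ 5 (m≤m+n 5 95) (≤-trans (m≤m+n _ _) (≤-trans (m≤n+m _ (costFactor L)) (m≤n+m _ (costFactor N))))))))
            (sumLoop-runs h≤ x<n k (c + E x k) (<⇒≤ k<l) (≤-trans (≤-reflexive total) ≤B))))
      where
      total : c + E x k + ∑[ j < k ] E x (toℕ j) ≡ c + ∑[ j < suc k ] E x (toℕ j)
      total = trans (+-assoc c (E x k) _) (cong (c +_) (sym (∑-last k (E x))))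
      before : Bounded B (state h x (suc k) c)
      before = state-bounded h≤ (<⇒≤ (<-≤-trans x<n n≤)) (≤-trans k<l l≤) (≤-trans (m≤m+n c _) ≤B)
      after : Bounded B (state h x k c)
      after = state-bounded h≤ (<⇒≤ (<-≤-trans x<n n≤)) (<⇒≤ (≤-trans k<l l≤)) (≤-trans (m≤m+n c _) ≤B)
      time : ∀ k u → u + ((u + u) + (1 + 3 * k) * u) ≡ (1 + 3 * suc k) * u
      time = solve-∀

    full : ℕ → ℕ
    full = fill n computed (V a)

    -- The rows x, …, n - 1 have been computed.
    partial : ℕ → ℕ → ℕ
    partial x = fill x (V a) full

    partial-≤ : ∀ x i → partial x i ≤ 2 ^ B
    partial-≤ x = fill-≤ {x} (V a) full (λ i _ → bounded a i) (fill-≤ {n} computed (V a) F≤ (bounded a))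

    partial-step : ∀ x {v} → x < n → v ≡ computed x → ∀ y →
                   (if does (x ≟ y) then v else partial (suc x) y) ≡ partial x y
    partial-step x {v} x<n v≡ y with <-cmp y x
    ... | tri< y<x y≢x _ = trans (trans (cong (if_then v else partial (suc x) y) (dec-false (x ≟ y) (y≢x ∘ sym)))
                                        (fill-< {suc x} (V a) full (m≤n⇒m≤1+n y<x)))
                                 (sym (fill-< {x} (V a) full y<x))
    ... | tri≈ _ refl _  = trans (trans (cong (if_then v else partial (suc x) y) (dec-true (x ≟ x) refl)) v≡)
                                 (sym (trans (fill-≥ {x} (V a) full ≤-refl) (fill-< {n} computed (V a) x<n)))
    ... | tri> _ y≢x x<y = trans (trans (cong (if_then v else partial (suc x) y) (dec-false (x ≟ y) (y≢x ∘ sym)))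
                                        (fill-≥ {suc x} (V a) full x<y))
                                 (sym (fill-≥ {x} (V a) full (<⇒≤ x<y)))

    row-runs : ∀ x → x < n →
      Runs (tabulateRow a L e f) (state (partial (suc x)) (suc x) 0 0) (state (partial x) x 0 0)
           ((5 + 3 * l) * u)
    row-runs x x<n =
      runs-mono (≤-reflexive (time l u))
        (runs-seq {S′ = state h x 0 0}
          (runs-assign (set-index (V ⟨ a ≔ h ⟩) (suc x) 0 0 x)
            (factor (state-bounded h≤ (≤-trans x<n n≤) z≤n z≤n) (const 0) (index ⊖ const 1)
              (literal≤κ 16 (m≤m+n 16 84))))
        (runs-seq {S′ = state h x l 0}
          (runs-assign (λ b i → trans (cong (λ z → (state h x 0 0 [ 3 , 1 ↦ z ]) b i) (L≡ h x x<n))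
                                      (set-counter (V ⟨ a ≔ h ⟩) x 0 0 l b i))
            (factor (state-bounded h≤ x≤ z≤n z≤n) (const 1) L
              (tail≤κ 4 (m≤m+n 4 96) (≤-trans (m≤m+n _ _) (m≤n+m _ (costFactor N))))))
        (runs-seq {S′ = state h x 0 Σx} (sumLoop-runs h≤ x<n l 0 ≤-refl (∑≤ x x<n))
        (runs-seq {S′ = state (partial x) x 0 Σx}
          (runs-assign (set-below V a h x (registers x 0 Σx) a≢3 (partial-step x x<n (f≡ h x Σx x<n (fill-< {suc x} (V a) full ≤-refl))))
            (factor (state-bounded h≤ x≤ z≤n (∑≤ x x<n)) index f
              (tail≤κ 6 (m≤m+n 6 94) (≤-trans (m≤n+m _ (costFactor (accumulator ⊕ e)))
                (≤-trans (m≤n+m _ (costFactor L)) (m≤n+m _ (costFactor N)))))))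
          (runs-assign (set-accumulator (V ⟨ a ≔ partial x ⟩) x 0 Σx 0)
            (factor (state-bounded (partial-≤ x) x≤ z≤n (∑≤ x x<n)) (const 2) (const 0)
              (literal≤κ 7 (m≤m+n 7 93))))))))
      where
      h = partial (suc x)
      h≤ = partial-≤ (suc x)
      x≤ = <⇒≤ (<-≤-trans x<n n≤)
      Σx = ∑[ k < l ] E x (toℕ k)
      time : ∀ l u → u + (u + ((1 + 3 * l) * u + (u + u))) ≡ (5 + 3 * l) * u
      time = solve-∀

    rows-run : ∀ x → x ≤ n →
      Runs (while index loop tabulateRow a L e f) (state (partial x) x 0 0) (state (partial 0) 0 0 0)
           ((1 + x * (6 + 3 * l)) * u)
    rows-run zero    x≤n = runs-mono (≤-reflexive (sym (+-identityʳ u)))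
      (runs-exit refl (test-factor (state-bounded (partial-≤ 0) z≤n z≤n z≤n) index
        (literal≤κ 6 (m≤m+n 6 94))))
    rows-run (suc x) x<n = runs-mono (≤-reflexive (time x l u))
      (runs-loop (λ ()) (test-factor (state-bounded (partial-≤ (suc x)) (≤-trans x<n n≤) z≤n z≤n) index
                          (literal≤κ 6 (m≤m+n 6 94)))
        (row-runs x x<n) (rows-run x (<⇒≤ x<n)))
      where
      time : ∀ x l u → u + ((5 + 3 * l) * u + (1 + x * (6 + 3 * l)) * u) ≡ (1 + suc x * (6 + 3 * l)) * u
      time = solve-∀

  tabulate-runs :
    Runs (tabulate a N L e f) (withRegisters V 0 0 0)
         (withRegisters (V ⟨ a ≔ fill n (λ x → F x (∑[ k < l ] E x (toℕ k))) (V a) ⟩) 0 0 0)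
         (6 * tabulateFactor N L e f * suc B * (suc n * suc l))
  tabulate-runs = runs-mono time≤ (runs-seq
      (runs-assign start
        (factor (set-≤ {a = 3} bounded (registers-≤ z≤n z≤n z≤n)) (const 0) N
          (tail≤κ 3 (m≤m+n 3 97) (m≤m+n _ _))))
      (rows-run n ≤-refl))
    where
    unchanged : ∀ b i → V b i ≡ (V ⟨ a ≔ partial n ⟩) b i
    unchanged b i with a ≟ b
    ... | no a≢b rewrite dec-false (a ≟ b) a≢b = refl
    ... | yes refl rewrite dec-true (a ≟ a) refl with i <? n
    ...   | yes i<n = sym (fill-< {n} (V a) full i<n)
    ...   | no  i≮n = sym (trans (fill-≥ {n} (V a) full (≮⇒≥ i≮n)) (fill-≥ {n} computed (V a) (≮⇒≥ i≮n)))
    start : withRegisters V 0 0 0 [ 3 , 0 ↦ ⟦ N ⟧ (withRegisters V 0 0 0) ] ≐ state (partial n) n 0 0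
    start b i = trans (cong (λ z → (withRegisters V 0 0 0 [ 3 , 0 ↦ z ]) b i) N≡)
      (trans (set-index V 0 0 0 n b i)
             (cong (λ z → if does (3 ≟ b) then registers n 0 0 i else z) (unchanged b i)))
    expand : ∀ n l u → u + (1 + n * (6 + 3 * l)) * u + (4 + 6 * l + 3 * (n * l)) * u
                     ≡ 6 * u * (suc n * suc l)
    expand = solve-∀
    regroup : ∀ k B z → 6 * (k * B) * z ≡ 6 * k * B * z
    regroup = solve-∀
    time≤ : u + (1 + n * (6 + 3 * l)) * u ≤ 6 * κ * suc B * (suc n * suc l)
    time≤ = begin
      -- The surplus added here completes the count to the product 6(n + 1)(l + 1).
      u + (1 + n * (6 + 3 * l)) * u                                     ≤⟨ m≤m+n _ _ ⟩
      u + (1 + n * (6 + 3 * l)) * u + (4 + 6 * l + 3 * (n * l)) * u     ≡⟨ expand n l u ⟩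
      6 * u * (suc n * suc l)                                           ≡⟨ regroup κ (suc B) (suc n * suc l) ⟩
      6 * κ * suc B * (suc n * suc l)                                   ∎
      where open ≤-Reasoning

-- Row-major indexing and composable program stages

quotient-combine : ∀ {m n} (i : Fin m) (j : Fin n) → quotient (toℕ (combine i j)) n ≡ toℕ i
quotient-combine {m} {suc n} i j = begin
  toℕ (combine i j) / suc n                ≡⟨ cong (_/ suc n) (Fin.toℕ-combine i j) ⟩
  (suc n * toℕ i + toℕ j) / suc n          ≡⟨ cong (_/ suc n) (trans (+-comm _ (toℕ j))
                                                 (cong (toℕ j +_) (*-comm (suc n) (toℕ i)))) ⟩
  (toℕ j + toℕ i * suc n) / suc n          ≡⟨ +-distrib-/-∣ʳ (toℕ j) (n∣m*n (toℕ i)) ⟩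
  toℕ j / suc n + toℕ i * suc n / suc n    ≡⟨ cong₂ _+_ (m<n⇒m/n≡0 (Fin.toℕ<n j)) (m*n/n≡m (toℕ i) (suc n)) ⟩
  toℕ i                                    ∎
  where open ≡-Reasoning

module _ {m n : ℕ} {x n′} (n′≡n : n′ ≡ n) {i : Fin m} {j : Fin n} (x≡ : x ≡ toℕ (combine i j)) where

  row-index : ∀ (k : Fin n) → n′ * quotient x n′ + toℕ k ≡ toℕ (combine i k)
  row-index k = trans (cong₂ (λ n x → n * quotient x n + toℕ k) n′≡n x≡)
    (trans (cong (λ z → n * z + toℕ k) (quotient-combine i j)) (sym (Fin.toℕ-combine i k)))

  column-index : x ∸ n′ * quotient x n′ ≡ toℕ j
  column-index = trans (cong₂ (λ n x → x ∸ n * quotient x n) n′≡n x≡)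
    (trans (cong₂ (λ x z → x ∸ n * z) (Fin.toℕ-combine i j) (quotient-combine i j))
           (m+n∸m≡n (n * toℕ i) (toℕ j)))

flat-index : ∀ {m n n′} → n′ ≡ n → (i : Fin m) (j : Fin n) → n′ * toℕ i + toℕ j ≡ toℕ (combine i j)
flat-index refl i j = sym (Fin.toℕ-combine i j)

-- Each `tabulate` starts and ends with all registers 0, which lets stages be chained without
-- mentioning registers.
idle : State → State
idle V = withRegisters V 0 0 0

opaque
  stageFactor : Expr → Expr → Expr → Expr → ℕ
  stageFactor N L e f = 6 * tabulateFactor N L e f

module Stages (B q : ℕ) where

  opaque
    -- Common unit of time: up to a constant, the price of a table whose dimensions are at most `q`
    -- on numbers of `B` digits. Running times of stages then add as plain coefficients.
    Y : ℕ
    Y = suc B * (suc q * suc q)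

  record Stage (κ : ℕ) (prog : Program) (a : ℕ) (V : State) (Spec : (ℕ → ℕ) → Set) : Set where
    field
      cells    : ℕ → ℕ
      runs     : Runs prog (idle V) (idle (V ⟨ a ≔ cells ⟩)) (κ * Y)
      cells≤   : Bounded B (V ⟨ a ≔ cells ⟩)
      contents : Spec cells

  open Stage public

  module _
    {V} (bounded : Bounded B V) a (a≢3 : a ≢ 3) (N L e f : Expr) {r l : ℕ}
    (E : Fin r → Fin l → ℕ) (F : Fin r → ℕ → ℕ)
    (N≡ : ⟦ N ⟧ (idle V) ≡ r)
    (L≡ : ∀ h x → ⟦ L ⟧ (withRegisters (V ⟨ a ≔ h ⟩) x 0 0) ≡ l)
    (e≡ : ∀ h x k c → ⟦ e ⟧ (withRegisters (V ⟨ a ≔ h ⟩) (toℕ x) (toℕ k) c) ≡ E x k)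
    (f≡ : ∀ h x c → h (toℕ x) ≡ V a (toℕ x) → ⟦ f ⟧ (withRegisters (V ⟨ a ≔ h ⟩) (toℕ x) 0 c) ≡ F x c)
    (r≤ : r ≤ 2 ^ B) (l≤ : l ≤ 2 ^ B) (r≤q : r ≤ q) (l≤q : l ≤ q)
    (∑≤ : ∀ x → ∑[ k < l ] E x k ≤ 2 ^ B)
    (F≤ : ∀ x → F x (∑[ k < l ] E x k) ≤ 2 ^ B)
    where

    private
      -- The specification lives on `Fin`, the loop on numbers. Evaluating the expressions in the
      -- initial state extends it to all numbers without inventing values outside the range.
      E′ F′ : ℕ → ℕ → ℕ
      E′ x k = ⟦ e ⟧ (withRegisters (V ⟨ a ≔ V a ⟩) x k 0)
      F′ x c = ⟦ f ⟧ (withRegisters (V ⟨ a ≔ V a ⟩) x 0 c)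

      e≡E′ : ∀ h x k c → x < r → k < l → ⟦ e ⟧ (withRegisters (V ⟨ a ≔ h ⟩) x k c) ≡ E′ x k
      e≡E′ h x k c x<r k<l = subst₂ (λ x k → ⟦ e ⟧ (withRegisters (V ⟨ a ≔ h ⟩) x k c) ≡ E′ x k)
        (Fin.toℕ-fromℕ< x<r) (Fin.toℕ-fromℕ< k<l) (trans (e≡ h _ _ c) (sym (e≡ (V a) _ _ 0)))

      f≡F′ : ∀ h x c → x < r → h x ≡ V a x → ⟦ f ⟧ (withRegisters (V ⟨ a ≔ h ⟩) x 0 c) ≡ F′ x c
      f≡F′ h x c x<r = subst (λ x → h x ≡ V a x → ⟦ f ⟧ (withRegisters (V ⟨ a ≔ h ⟩) x 0 c) ≡ F′ x c)
        (Fin.toℕ-fromℕ< x<r) λ hx → trans (f≡ h _ c hx) (sym (f≡ (V a) _ c refl))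

      ∑E′ : ∀ x → ∑[ k < l ] E′ (toℕ x) (toℕ k) ≡ ∑[ k < l ] E x k
      ∑E′ x = sum-cong-≗ {l} λ k → e≡ (V a) x k 0

      F′≡ : ∀ x → F′ (toℕ x) (∑[ k < l ] E′ (toℕ x) (toℕ k)) ≡ F x (∑[ k < l ] E x k)
      F′≡ x = trans (f≡ (V a) x _ refl) (cong (F x) (∑E′ x))

      ∑E′≤ : ∀ x → x < r → ∑[ k < l ] E′ x (toℕ k) ≤ 2 ^ B
      ∑E′≤ x x<r = subst (λ x → ∑[ k < l ] E′ x (toℕ k) ≤ 2 ^ B) (Fin.toℕ-fromℕ< x<r)
        (≤-trans (≤-reflexive (∑E′ _)) (∑≤ _))

      F′≤ : ∀ x → x < r → F′ x (∑[ k < l ] E′ x (toℕ k)) ≤ 2 ^ B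
      F′≤ x x<r = subst (λ x → F′ x (∑[ k < l ] E′ x (toℕ k)) ≤ 2 ^ B) (Fin.toℕ-fromℕ< x<r)
        (≤-trans (≤-reflexive (F′≡ _)) (F≤ _))

      computed : ℕ → ℕ
      computed x = F′ x (∑[ k < l ] E′ x (toℕ k))

    opaque
      unfolding Y stageFactor

      stage : Stage (stageFactor N L e f) (tabulate a N L e f) a V
                (λ g → ∀ x → g (toℕ x) ≡ F x (∑[ k < l ] E x k))
      stage = record
        { cells    = fill r computed (V a)
        ; runs     = runs-mono (≤-trans (*-monoʳ-≤ (6 * tabulateFactor N L e f * suc B)
                                          (*-mono-≤ (s≤s r≤q) (s≤s l≤q)))
                                        (≤-reflexive (*-assoc (6 * tabulateFactor N L e f) (suc B) _)))
                       (tabulate-runs bounded a≢3 {N} {L} {e} {f} {r} {l} {E′} {F′}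
                         N≡ (λ h x _ → L≡ h x) e≡E′ f≡F′ r≤ l≤ ∑E′≤ F′≤)
        ; cells≤   = set-≤ {a = a} bounded (fill-≤ {r} computed (V a) F′≤ (bounded a))
        ; contents = λ x → trans (fill-< {r} computed (V a) (Fin.toℕ<n x)) (F′≡ x)
        }

  opaque
    matrix-stage : ∀ {V} (bounded : Bounded B V) a (a≢3 : a ≢ 3) (N L e f : Expr) {m n l : ℕ}
      (E : Fin m → Fin n → Fin l → ℕ) (F : Fin m → Fin n → ℕ → ℕ)
      (N≡ : ⟦ N ⟧ (idle V) ≡ m * n)
      (L≡ : ∀ h x → ⟦ L ⟧ (withRegisters (V ⟨ a ≔ h ⟩) x 0 0) ≡ l)
      (e≡ : ∀ h i j k c x → x ≡ toℕ (combine i j) → ⟦ e ⟧ (withRegisters (V ⟨ a ≔ h ⟩) x (toℕ k) c) ≡ E i j k)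
      (f≡ : ∀ h i j c x → x ≡ toℕ (combine i j) → h x ≡ V a x →
            ⟦ f ⟧ (withRegisters (V ⟨ a ≔ h ⟩) x 0 c) ≡ F i j c)
      (r≤ : m * n ≤ 2 ^ B) (l≤ : l ≤ 2 ^ B) (r≤q : m * n ≤ q) (l≤q : l ≤ q)
      (∑≤ : ∀ i j → ∑[ k < l ] E i j k ≤ 2 ^ B)
      (F≤ : ∀ i j → F i j (∑[ k < l ] E i j k) ≤ 2 ^ B) →
      Stage (stageFactor N L e f) (tabulate a N L e f) a V
        (λ g → ∀ i j → g (toℕ (combine i j)) ≡ F i j (∑[ k < l ] E i j k))
    matrix-stage {V} bounded a a≢3 N L e f {m} {n} {l} E F N≡ L≡ e≡ f≡ r≤ l≤ r≤q l≤q ∑≤ F≤ = record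
      { cells    = cells flat
      ; runs     = runs flat
      ; cells≤   = cells≤ flat
      ; contents = λ i j → trans (contents flat (combine i j))
          (cong (λ ij → F (proj₁ ij) (proj₂ ij) (∑[ k < l ] E (proj₁ ij) (proj₂ ij) k)) (Fin.remQuot-combine i j))
      }
      where
      row : Fin (m * n) → Fin m
      row x = proj₁ (remQuot {m} n x)
      column : Fin (m * n) → Fin n
      column x = proj₂ (remQuot {m} n x)
      position : ∀ x → toℕ x ≡ toℕ (combine (row x) (column x))
      position x = cong toℕ (sym (Fin.combine-remQuot {m} n x))
      flat : Stage (stageFactor N L e f) (tabulate a N L e f) a V
               (λ g → ∀ x → g (toℕ x) ≡ F (row x) (column x) (∑[ k < l ] E (row x) (column x) k))
      flat = stage bounded a a≢3 N L e f (λ x → E (row x) (column x)) (λ x → F (row x) (column x))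
        N≡ L≡ (λ h x k c → e≡ h (row x) (column x) k c (toℕ x) (position x))
        (λ h x c → f≡ h (row x) (column x) c (toℕ x) (position x))
        r≤ l≤ r≤q l≤q (λ x → ∑≤ (row x) (column x)) (λ x → F≤ (row x) (column x))

-- The program.  Besides input, output and registers, array 4 holds the accumulated
-- times, 5 the regrets, 6 the charged amount, 7 the number of remaining rounds, and
-- 8, 9 and 10 hold the times, the totals and their weighted sum in the current round.

clientsE daysE jobsE rowE columnE : Expr
clientsE = 0 [ const 0 ]
daysE    = 0 [ const 1 ]
jobsE    = daysE ⊗ clientsE
rowE     = clientsE ⊗ (index ⊘ clientsE)
columnE  = index ⊖ rowE

inRow inColumn : ℕ → Expr
inRow a    = a [ rowE ⊕ counter ]
inColumn a = a [ clientsE ⊗ counter ⊕ index ]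

ltE precE : Expr → Expr → Expr
ltE e f   = const 1 ⊖ (const 1 ⊖ (f ⊖ e))
precE e f = const 1 ⊕ ltE e f ⊖ ltE f e

timesE chargedE roundsE ranksE : Expr
timesE   = precE (inRow 1 ⊗ 5 [ columnE ]) (1 [ index ] ⊗ 5 [ counter ]) ⊗ inRow 1
chargedE = 6 [ index ] ⊕ (10 [ const 0 ] ⊕ (accumulator ⊖ const 1)) ⊘ accumulator
roundsE  = const 4 ⊗ (clientsE ⊗ clientsE ⊗ clientsE ⊗ clientsE ⊗ clientsE)
ranksE   = ltE (clientsE ⊗ inRow 4 ⊕ counter) (clientsE ⊗ 4 [ index ] ⊕ columnE)

initialise oneRound sortRows algorithm : Program
initialise = tabulate 7 (const 1) (const 0) (const 0) roundsE
oneRound =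
  tabulate 8 jobsE clientsE timesE (1 [ index ] ⊕ accumulator) ⨾
  tabulate 9 clientsE daysE (inColumn 8) accumulator ⨾
  tabulate 10 (const 1) clientsE (5 [ counter ] ⊗ 9 [ counter ]) accumulator ⨾
  tabulate 6 (const 1) clientsE (5 [ counter ]) chargedE ⨾
  tabulate 4 jobsE (const 0) (const 0) (4 [ index ] ⊕ 8 [ index ]) ⨾
  tabulate 5 clientsE daysE (inColumn 4) (accumulator ⊖ 6 [ const 0 ]) ⨾
  tabulate 7 (const 1) (const 0) (const 0) (7 [ index ] ⊖ const 1)
sortRows = tabulate 2 jobsE clientsE ranksE accumulator
-- With no jobs, the other dimension can be exponential in the length of the input, so the loops
-- must not be entered.
algorithm = test jobsE
  then (initialise ⨾ (while 7 [ const 0 ] loop oneRound) ⨾ sortRows)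
  else skip

roundFactor : ℕ
roundFactor =
  stageFactor jobsE clientsE timesE (1 [ index ] ⊕ accumulator) +
  (stageFactor clientsE daysE (inColumn 8) accumulator +
  (stageFactor (const 1) clientsE (5 [ counter ] ⊗ 9 [ counter ]) accumulator +
  (stageFactor (const 1) clientsE (5 [ counter ]) chargedE +
  (stageFactor jobsE (const 0) (const 0) (4 [ index ] ⊕ 8 [ index ]) +
  (stageFactor clientsE daysE (inColumn 4) (accumulator ⊖ 6 [ const 0 ]) +
  stageFactor (const 1) (const 0) (const 0) (7 [ index ] ⊖ const 1))))))

initialFactor sortFactor : ℕ
initialFactor = stageFactor (const 1) (const 0) (const 0) roundsE
sortFactor = stageFactor jobsE clientsE ranksE accumulator

-- Correctness and cost of the program, given bounds on all intermediate numbers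

module _ (I : Instance) where
  open Instance I renaming (clients to n; days to m)

  module Execution (B q : ℕ)
    (n≤q : n ≤ q) (m≤q : m ≤ q) (jobs≤q : m * n ≤ q) (1≤q : 1 ≤ q) (q≤ : q ≤ 2 ^ B)
    (input≤ : Bounded B (input I)) (rounds≤ : rounds n ≤ 2 ^ B)
    (times≤B : ∀ t → t ≤ rounds n → ∀ i j → times p (regret p t) i j ≤ 2 ^ B)
    (totals≤B : ∀ t → t ≤ rounds n → ∀ j → totals p (regret p t) j ≤ 2 ^ B)
    (weighted≤B : ∀ t → t ≤ rounds n → ∑[ j < n ] (regret p t j * totals p (regret p t) j) ≤ 2 ^ B)
    (weights≤B : ∀ t → t ≤ rounds n → ∑[ j < n ] regret p t j ≤ 2 ^ B)
    (charged≤B : ∀ t → t ≤ rounds n → charged p t ≤ 2 ^ B)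
    (accumulated≤B : ∀ t → t ≤ rounds n → ∀ i j → accumulated p t i j ≤ 2 ^ B)
    (sums≤B : ∀ t → t ≤ rounds n → ∀ j → ∑[ i < m ] accumulated p t i j ≤ 2 ^ B)
    where

    open Stages B q

    -- Loop invariant after `t` rounds with `c` to go. Arrays 8, 9 and 10 are absent because each
    -- round rewrites the cells of them that it reads.
    record Represents (t c : ℕ) (V : State) : Set where
      field
        bounded      : Bounded B V
        clients≡     : V 0 0 ≡ n
        days≡        : V 0 1 ≡ m
        p≡           : ∀ i j → V 1 (toℕ (combine i j)) ≡ p i j
        accumulated≡ : ∀ i j → V 4 (toℕ (combine i j)) ≡ accumulated p t i j
        regret≡      : ∀ j → V 5 (toℕ j) ≡ regret p t j
        charged≡     : V 6 0 ≡ charged p t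
        rounds≡      : V 7 0 ≡ c

    runs-seq-* : ∀ {c d S S′ S″} κ κ′ → Runs c S S′ (κ * Y) → Runs d S′ S″ (κ′ * Y) →
                 Runs (c ⨾ d) S S″ ((κ + κ′) * Y)
    runs-seq-* κ κ′ run run′ = runs-mono (≤-reflexive (sym (*-distribʳ-+ Y κ κ′))) (runs-seq run run′)

    private
      n≤B = ≤-trans n≤q q≤
      m≤B = ≤-trans m≤q q≤
      jobs≤B = ≤-trans jobs≤q q≤
      1≤B = ≤-trans 1≤q q≤

    round-runs : ∀ {t c V} → t < rounds n → Represents t (suc c) V →
      ∃[ V′ ] (Runs oneRound (idle V) (idle V′) (roundFactor * Y) × Represents (suc t) c V′)
    round-runs {t} {c} {V} t<T rep = V₇ ,
      runs-seq-* (stageFactor jobsE clientsE timesE (1 [ index ] ⊕ accumulator)) _ (runs stage₁)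
      (runs-seq-* (stageFactor clientsE daysE (inColumn 8) accumulator) _ (runs stage₂)
      (runs-seq-* (stageFactor (const 1) clientsE (5 [ counter ] ⊗ 9 [ counter ]) accumulator) _ (runs stage₃)
      (runs-seq-* (stageFactor (const 1) clientsE (5 [ counter ]) chargedE) _ (runs stage₄)
      (runs-seq-* (stageFactor jobsE (const 0) (const 0) (4 [ index ] ⊕ 8 [ index ])) _ (runs stage₅)
      (runs-seq-* (stageFactor clientsE daysE (inColumn 4) (accumulator ⊖ 6 [ const 0 ])) _ (runs stage₆)
      (runs stage₇)))))) ,
      record
        { bounded      = cells≤ stage₇
        ; clients≡     = clients≡
        ; days≡        = days≡
        ; p≡           = p≡
        ; accumulated≡ = contents stage₅
        ; regret≡      = contents stage₆
        ; charged≡     = contents stage₄ zero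
        ; rounds≡      = contents stage₇ zero
        }
      where
      open Represents rep
      w = regret p t
      t≤T = <⇒≤ t<T

      stage₁ = matrix-stage bounded 8 (λ ()) jobsE clientsE timesE (1 [ index ] ⊕ accumulator)
        (λ i j k → smith (p i) w k j * p i k) (λ i j c → p i j + c)
        (cong₂ _*_ days≡ clients≡) (λ _ _ → clients≡)
        (λ h i j k c x x≡ →
          let pₖ = trans (cong (V 1) (row-index {m} {n} clients≡ x≡ k)) (p≡ i k)
              pⱼ = trans (cong (V 1) x≡) (p≡ i j)
              wⱼ = trans (cong (V 5) (column-index {m} {n} clients≡ x≡)) (regret≡ j)
          in cong₂ _*_ (cong₂ prec (cong₂ _*_ pₖ wⱼ) (cong₂ _*_ pⱼ (regret≡ k))) pₖ)
        (λ h i j c x x≡ _ → cong (_+ c) (trans (cong (V 1) x≡) (p≡ i j)))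
        jobs≤B n≤B jobs≤q n≤q
        (λ i j → ≤-trans (m≤n+m _ (p i j)) (times≤B t t≤T i j)) (times≤B t t≤T)
      V₁ = V ⟨ 8 ≔ cells stage₁ ⟩

      stage₂ = stage {V₁} (cells≤ stage₁) 9 (λ ()) clientsE daysE (inColumn 8) accumulator
        (λ j i → times p w i j) (λ j c → c)
        clients≡ (λ _ _ → days≡)
        (λ h j i c → trans (cong (cells stage₁) (flat-index clients≡ i j)) (contents stage₁ i j))
        (λ h j c _ → refl)
        n≤B m≤B n≤q m≤q (totals≤B t t≤T) (totals≤B t t≤T)
      V₂ = V₁ ⟨ 9 ≔ cells stage₂ ⟩

      stage₃ = stage {V₂} (cells≤ stage₂) 10 (λ ())
        (const 1) clientsE (5 [ counter ] ⊗ 9 [ counter ]) accumulator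
        {1} (λ _ j → w j * totals p w j) (λ _ c → c)
        refl (λ _ _ → clients≡)
        (λ h x j c → cong₂ _*_ (regret≡ j) (contents stage₂ j))
        (λ h x c _ → refl)
        1≤B n≤B 1≤q n≤q (λ _ → weighted≤B t t≤T) (λ _ → weighted≤B t t≤T)
      V₃ = V₂ ⟨ 10 ≔ cells stage₃ ⟩

      stage₄ = stage {V₃} (cells≤ stage₃) 6 (λ ())
        (const 1) clientsE (5 [ counter ]) chargedE
        {1} (λ _ j → w j)
        (λ _ c → charged p t + quotient (∑[ j < n ] (w j * totals p w j) + (c ∸ 1)) c)
        refl (λ _ _ → clients≡)
        (λ h x j c → regret≡ j)
        (λ { h zero c h≡ → cong₂ (λ a x → a + quotient (x + (c ∸ 1)) c) (trans h≡ charged≡)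
                                  (contents stage₃ zero) })
        1≤B n≤B 1≤q n≤q (λ _ → weights≤B t t≤T) (λ _ → charged≤B (suc t) t<T)
      V₄ = V₃ ⟨ 6 ≔ cells stage₄ ⟩

      stage₅ = matrix-stage {V₄} (cells≤ stage₄) 4 (λ ())
        jobsE (const 0) (const 0) (4 [ index ] ⊕ 8 [ index ])
        {m} {n} {0} (λ _ _ _ → 0) (λ i j _ → accumulated p (suc t) i j)
        (cong₂ _*_ days≡ clients≡) (λ _ _ → refl)
        (λ h i j k c x x≡ → refl)
        (λ h i j c x x≡ h≡ → cong₂ _+_ (trans h≡ (trans (cong (V 4) x≡) (accumulated≡ i j)))
          (trans (cong (cells stage₁) x≡) (contents stage₁ i j)))
        jobs≤B z≤n jobs≤q z≤n (λ _ _ → z≤n) (accumulated≤B (suc t) t<T)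
      V₅ = V₄ ⟨ 4 ≔ cells stage₅ ⟩

      stage₆ = stage {V₅} (cells≤ stage₅) 5 (λ ())
        clientsE daysE (inColumn 4) (accumulator ⊖ 6 [ const 0 ])
        (λ j i → accumulated p (suc t) i j) (λ j c → c ∸ charged p (suc t))
        clients≡ (λ _ _ → days≡)
        (λ h j i c → trans (cong (cells stage₅) (flat-index clients≡ i j)) (contents stage₅ i j))
        (λ h j c _ → cong (c ∸_) (contents stage₄ zero))
        n≤B m≤B n≤q m≤q (sums≤B (suc t) t<T)
        (λ j → ≤-trans (m∸n≤m _ (charged p (suc t))) (sums≤B (suc t) t<T j))
      V₆ = V₅ ⟨ 5 ≔ cells stage₆ ⟩

      stage₇ = stage {V₆} (cells≤ stage₆) 7 (λ ())
        (const 1) (const 0) (const 0) (7 [ index ] ⊖ const 1)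
        {1} {0} (λ _ _ → 0) (λ _ _ → c)
        refl (λ _ _ → refl) (λ _ _ _ _ → refl)
        (λ { h zero _ h≡ → cong (_∸ 1) (trans h≡ rounds≡) })
        1≤B z≤n 1≤q z≤n (λ _ → z≤n)
        (λ _ → ≤-trans (n≤1+n c) (subst (_≤ 2 ^ B) rounds≡ (bounded 7 0)))
      V₇ = V₆ ⟨ 7 ≔ cells stage₇ ⟩

    private
      loopFactor : ℕ → ℕ
      -- Each 6 pays for one loop test: it is `1 + costFactor (7 [ const 0 ])`.
      loopFactor c = 6 + c * (6 + roundFactor)

      cost≤Y : ∀ {S} → Bounded B S → ∀ e → 1 + cost e S ≤ (1 + costFactor e) * Y
      cost≤Y {S} bounded e = ≤-trans (+-mono-≤ (s≤s z≤n) (cost≤ bounded e))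
        (*-monoʳ-≤ (1 + costFactor e) B≤Y)
        where
        opaque
          unfolding Y
          B≤Y : suc B ≤ Y
          B≤Y = m≤m*n (suc B) (suc q * suc q)

      idle≤ : ∀ {V} → Bounded B V → Bounded B (idle V)
      idle≤ bounded = set-≤ {a = 3} bounded (registers-≤ z≤n z≤n z≤n)

    loop-runs : ∀ c {t V} → t + c ≡ rounds n → Represents t c V →
      ∃[ V′ ] (Runs (while 7 [ const 0 ] loop oneRound) (idle V) (idle V′) (loopFactor c * Y)
               × Represents (rounds n) 0 V′)
    loop-runs zero {t} {V} t≡T rep = V ,
      runs-exit rounds≡ (cost≤Y (idle≤ bounded) (7 [ const 0 ])) ,
      subst (λ t → Represents t 0 V) (trans (sym (+-identityʳ t)) t≡T) rep
      where open Represents rep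
    loop-runs (suc c) {t} {V} t+c≡T rep =
      proj₁ rest , runs-mono (≤-reflexive (time c roundFactor Y))
        (runs-loop {S = idle V} {S′ = idle (proj₁ round)} {S″ = idle (proj₁ rest)}
          (λ ≡0 → contradiction (trans (sym rounds≡) ≡0) λ ())
          (cost≤Y (idle≤ bounded) (7 [ const 0 ])) (proj₁ (proj₂ round)) (proj₁ (proj₂ rest))) ,
      proj₂ (proj₂ rest)
      where
      open Represents rep
      round = round-runs (≤-trans (s≤s (m≤m+n t c)) (≤-reflexive (trans (sym (+-suc t c)) t+c≡T))) rep
      rest  = loop-runs c (trans (sym (+-suc t c)) t+c≡T) (proj₂ (proj₂ round))
      time : ∀ c r Y → 6 * Y + (r * Y + (6 + c * (6 + r)) * Y) ≡ (6 + suc c * (6 + r)) * Y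
      time = solve-∀

    initialise-runs : ∃[ V ] (Runs initialise (idle (input I)) (idle V) (initialFactor * Y)
                              × Represents 0 (rounds n) V)
    initialise-runs = input I ⟨ 7 ≔ cells initial ⟩ , runs initial , record
        { bounded      = cells≤ initial
        ; clients≡     = refl
        ; days≡        = refl
        ; p≡           = entry≡
        ; accumulated≡ = λ _ _ → refl
        ; regret≡      = λ j → sym (∑-zero {m} λ _ → refl)
        ; charged≡     = refl
        ; rounds≡      = contents initial zero
        }
      where
      initial = stage {input I} input≤ 7 (λ ()) (const 1) (const 0) (const 0) roundsE
        {1} {0} (λ _ _ → 0) (λ _ _ → rounds n)
        refl (λ _ _ → refl) (λ _ _ _ _ → refl) (λ _ _ _ _ → refl)
        1≤B z≤n 1≤q z≤n (λ _ → z≤n) (λ _ → rounds≤)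
      entry≡ : ∀ i j → entry I (toℕ (combine i j)) (toℕ (combine i j) <? m * n) ≡ p i j
      entry≡ i j with toℕ (combine i j) <? m * n
      ... | yes k< = trans (cong (λ k → uncurry p (remQuot {m} n k)) (Fin.fromℕ<-toℕ (combine i j) k<))
                           (cong (uncurry p) (Fin.remQuot-combine i j))
      ... | no  k≮ = contradiction (Fin.toℕ<n (combine i j)) k≮

    sort-runs : ∀ {V} → Represents (rounds n) 0 V →
      ∃[ V′ ] (Runs sortRows (idle V) (idle V′) (sortFactor * Y)
               × (∀ i j → V′ 2 (toℕ (combine i j)) ≡ rank (tie-broken (accumulated p (rounds n) i)) j))
    sort-runs {V} rep = V ⟨ 2 ≔ cells sorted ⟩ , runs sorted , contents sorted
      where
      open Represents rep
      key : Fin m → Vector ℕ n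
      key i = tie-broken (accumulated p (rounds n) i)
      rank≤ : ∀ i j → rank (key i) j ≤ 2 ^ B
      rank≤ i j = ≤-trans (<⇒≤ (rank<n (key i) j)) n≤B
      sorted = matrix-stage bounded 2 (λ ()) jobsE clientsE ranksE accumulator
        (λ i j k → lt (key i k) (key i j)) (λ _ _ c → c)
        (cong₂ _*_ days≡ clients≡) (λ _ _ → clients≡)
        (λ h i j k c x x≡ → cong₂ lt
          (cong (_+ toℕ k) (cong₂ _*_ clients≡
            (trans (cong (V 4) (row-index {m} {n} clients≡ x≡ k)) (accumulated≡ i k))))
          (cong₂ _+_ (cong₂ _*_ clients≡ (trans (cong (V 4) x≡) (accumulated≡ i j)))
                     (column-index {m} {n} clients≡ x≡)))
        (λ _ _ _ _ _ _ _ → refl)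
        jobs≤B n≤B jobs≤q n≤q rank≤ rank≤

    input-idle : input I ≐ idle (input I)
    input-idle 0 i = refl
    input-idle 1 i = refl
    input-idle 2 i = refl
    input-idle 3 0 = refl
    input-idle 3 1 = refl
    input-idle 3 2 = refl
    input-idle 3 (suc (suc (suc i))) = refl
    input-idle (suc (suc (suc (suc a)))) i = refl

    algorithm-runs : m * n ≢ 0 → ∃[ s ] ∃[ t ] (⟨ algorithm , input I ⟩⇓⟨ s , t ⟩
      × t ≤ (17 + (initialFactor + (loopFactor (rounds n) + sortFactor))) * Y
      × (∀ i j → s 2 (toℕ (combine i j)) ≡ rank (tie-broken (accumulated p (rounds n) i)) j))
    algorithm-runs jobs≢0 =
      _ , _ , ⇓-then jobs≢0 (proj₁ (proj₂ (proj₂ execution)))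
      -- The 17 is `1 + costFactor jobsE`, the price of the outer test.
      , ≤-trans (+-mono-≤ (cost≤Y input≤ jobsE) (proj₂ (proj₂ (proj₂ (proj₂ execution)))))
                (≤-reflexive (sym (*-distribʳ-+ Y 17 (initialFactor + (loopFactor (rounds n) + sortFactor)))))
      , λ i j → trans (proj₁ (proj₂ (proj₂ (proj₂ execution))) 2 _) (proj₂ (proj₂ sorted) i j)
      where
      initial = initialise-runs
      iterated = loop-runs (rounds n) refl (proj₂ (proj₂ initial))
      sorted = sort-runs (proj₂ (proj₂ iterated))
      execution = runs-seq-* initialFactor (loopFactor (rounds n) + sortFactor) (proj₁ (proj₂ initial))
        (runs-seq-* (loopFactor (rounds n)) sortFactor (proj₁ (proj₂ iterated)) (proj₁ (proj₂ sorted))) input-idle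

-- Encoding length

-- Strong induction along halving, which shortens a number by exactly one digit.
<2^len : ∀ x → x < 2 ^ len x
<2^len = <-rec (λ x → x < 2 ^ len x) step
  where
  step : ∀ x → (∀ {y} → y < x → y < 2 ^ len y) → x < 2 ^ len x
  step zero rec = s≤s z≤n
  step (suc zero) rec = s≤s (s≤s z≤n)
  step x@(suc (suc x′)) rec = begin-strict
    x                                        ≡⟨ ⌊n/2⌋+⌈n/2⌉≡n x ⟨
    h + ⌈ x /2⌉                              ≤⟨ +-monoʳ-≤ h (⌊n/2⌋-mono (n≤1+n (suc x))) ⟩
    h + suc h                                <⟨ +-mono-<-≤ (rec (⌊n/2⌋<n (suc x′))) (rec (⌊n/2⌋<n (suc x′))) ⟩
    2 ^ len h + 2 ^ len h                    ≡⟨ cong (2 ^ len h +_) (+-identityʳ (2 ^ len h)) ⟨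
    2 ^ suc (len h)                          ≡⟨ cong (λ k → 2 ^ suc k) len-half ⟩
    2 ^ len x                                ∎
    where
    open ≤-Reasoning
    h = ⌊ x /2⌋
    len-half : len h ≡ ⌊log₂ x ⌋
    len-half = trans (cong suc (⌊log₂⌊n/2⌋⌋≡⌊log₂n⌋∸1 x))
      (m+[n∸m]≡n (⌊log₂⌋-mono-≤ {2} {x} (s≤s (s≤s z≤n))))

-- Rests on `1 + (x + y) ≤ (1 + x) * (1 + y)`. Strictness in the hypothesis supplies the summands 1,
-- so a sum fits into the added lengths of its terms.
∑<2^∑ : ∀ {n} {f g : Vector ℕ n} → (∀ i → f i < 2 ^ g i) → ∑[ i < n ] f i < 2 ^ (∑[ i < n ] g i)
∑<2^∑ {zero}          f<2^g = s≤s z≤n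
∑<2^∑ {suc n} {f} {g} f<2^g = begin
  1 + (x + y)            ≤⟨ m≤m+n _ (x * y) ⟩
  1 + (x + y) + x * y    ≡⟨ factor x y ⟩
  (1 + x) * (1 + y)      ≤⟨ *≤2^ {a = g zero} (f<2^g zero) (∑<2^∑ {n} (f<2^g ∘ suc)) ⟩
  2 ^ (∑[ i < suc n ] g i) ∎
  where
  open ≤-Reasoning
  x = f zero
  y = ∑[ i < n ] f (suc i)
  factor : ∀ x y → 1 + (x + y) + x * y ≡ (1 + x) * (1 + y)
  factor = solve-∀

opaque
  unfolding Stages.Y
  Y≡ : ∀ B q → Stages.Y B q ≡ suc B * (suc q * suc q)
  Y≡ B q = refl

module _ (I : Instance) where
  open Instance I renaming (clients to n; days to m)

  private
    S R B P M : ℕ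
    S = size I
    R = rounds n
    -- The largest number is the weighted sum of the totals: at most `2 ^ S` clients, regrets up to
    -- `2 ^ (11 * S)` and totals up to `2 ^ (3 * S)`, and 1 + 11 + 3 = 15.
    B = 15 * S
    P = ∑[ i < m ] ∑[ j < n ] p i j
    M = 3 * P

  size-positive : 1 ≤ S
  size-positive = s≤s z≤n

  clients<2^size : n < 2 ^ S
  clients<2^size = <-≤-trans (<2^len n) (^-monoʳ-≤ 2 (≤-trans (m≤m+n (len n) (len m)) (m≤m+n _ _)))

  days<2^size : m < 2 ^ S
  days<2^size = <-≤-trans (<2^len m) (^-monoʳ-≤ 2 (≤-trans (m≤n+m (len m) (len n)) (m≤m+n _ _)))

  volume<2^size : P < 2 ^ S
  volume<2^size = <-≤-trans (∑<2^∑ {m} λ i → ∑<2^∑ {n} λ j → <2^len (p i j))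
    (^-monoʳ-≤ 2 (m≤n+m _ (len n + len m)))

  -- Every processing time has at least one digit. Therefore, once there are jobs, `rounds n` is
  -- polynomial in the encoding length although `n` itself is written in binary.
  jobs≤size : m * n ≤ S
  jobs≤size = begin
    m * n                                 ≡⟨ cong (m *_) (*-identityʳ n) ⟨
    m * (n * 1)                           ≡⟨ trans (sum-cong-≗ {m} λ _ → ∑-const n 1) (∑-const m (n * 1)) ⟨
    ∑[ i < m ] ∑[ j < n ] 1               ≤⟨ ∑-mono {m} (λ i → ∑-mono {n} λ j → s≤s z≤n) ⟩
    ∑[ i < m ] ∑[ j < n ] len (p i j)     ≤⟨ m≤n+m _ (len n + len m) ⟩
    S                                     ∎
    where open ≤-Reasoning

  input-bounded : Bounded B (input I)
  input-bounded a i = ≤-trans (cell a i) (^-monoʳ-≤ 2 (m≤n*m S 15))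
    where
    entry≤ : ∀ k k<? → entry I k k<? ≤ 2 ^ S
    entry≤ k (yes k<) = ≤-trans (≤-trans
      (term≤∑ (p (proj₁ (remQuot {m} n (fromℕ< k<)))) (proj₂ (remQuot {m} n (fromℕ< k<))))
      (term≤∑ (λ i → ∑[ j < n ] p i j) (proj₁ (remQuot {m} n (fromℕ< k<))))) (<⇒≤ volume<2^size)
    entry≤ k (no _) = z≤n
    cell : ∀ a i → input I a i ≤ 2 ^ S
    cell 0 0 = <⇒≤ clients<2^size
    cell 0 1 = <⇒≤ days<2^size
    cell 0 (suc (suc _)) = z≤n
    cell 1 k = entry≤ k (k <? m * n)
    cell (suc (suc _)) _ = z≤n

  private
    infix 4 _≤2^[_]
    _≤2^[_] : ℕ → ℕ → Set
    x ≤2^[ k ] = x ≤ 2 ^ (k * S)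

    once : ∀ {x} → x ≤ 2 ^ S → x ≤2^[ 1 ]
    once x≤ = ≤-trans x≤ (^-monoʳ-≤ 2 (m≤n*m S 1))

    times-2^ : ∀ k l {x y} → x ≤2^[ k ] → y ≤2^[ l ] → x * y ≤2^[ k + l ]
    times-2^ k l x≤ y≤ = ≤-trans (*≤2^ {a = k * S} {l * S} x≤ y≤)
      (≤-reflexive (cong (2 ^_) (sym (*-distribʳ-+ S k l))))

    weaken : ∀ k {x} → k ≤ 15 → x ≤2^[ k ] → x ≤ 2 ^ B
    weaken k k≤ x≤ = ≤-trans x≤ (^-monoʳ-≤ 2 (*-monoˡ-≤ S k≤))

    four : 4 ≤2^[ 2 ]
    four = ^-monoʳ-≤ 2 (*-monoʳ-≤ 2 size-positive)

    n≤ : n ≤2^[ 1 ]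
    n≤ = once (<⇒≤ clients<2^size)

    M≤ : M ≤2^[ 3 ]
    M≤ = times-2^ 2 1 (≤-trans (n≤1+n 3) four) (once (<⇒≤ volume<2^size))

    R≤ : R ≤2^[ 7 ]
    R≤ = times-2^ 2 5 four (times-2^ 4 1 (times-2^ 3 1 (times-2^ 2 1 (times-2^ 1 1 n≤ n≤) n≤) n≤) n≤)

    tM≤ : ∀ t → t ≤ R → t * M ≤2^[ 10 ]
    tM≤ t t≤R = times-2^ 7 3 (≤-trans t≤R R≤) M≤

    times≤ₖ : ∀ w i j → times p w i j ≤2^[ 3 ]
    times≤ₖ w i j = ≤-trans (term≤∑ (λ i → times p w i j) i) (≤-trans (totals≤ p w j) M≤)

    sums≤ₖ : ∀ t → t ≤ R → ∀ j → ∑[ i < m ] accumulated p t i j ≤2^[ 11 ]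
    sums≤ₖ t t≤R j = ≤-trans (∑-bound {m} λ i → accumulated≤ p t i j)
      (times-2^ 1 10 (once (<⇒≤ days<2^size)) (tM≤ t t≤R))

    regret≤ₖ : ∀ t → t ≤ R → ∀ j → regret p t j ≤2^[ 11 ]
    regret≤ₖ t t≤R j = ≤-trans (m∸n≤m _ (charged p t)) (sums≤ₖ t t≤R j)

  sorted-rows : m * n ≢ 0 → ∃[ s ] ∃[ t ] (⟨ algorithm , input I ⟩⇓⟨ s , t ⟩
    × t ≤ (17 + (initialFactor + ((6 + R * (6 + roundFactor)) + sortFactor))) * (suc B * (suc S * suc S))
    × (∀ i j → s 2 (toℕ (combine i j)) ≡ rank (tie-broken (accumulated p R i)) j))
  sorted-rows jobs≢0 = subst (λ Y → ∃[ s ] ∃[ t ] (⟨ algorithm , input I ⟩⇓⟨ s , t ⟩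
      × t ≤ (17 + (initialFactor + ((6 + R * (6 + roundFactor)) + sortFactor))) * Y
      × (∀ i j → s 2 (toℕ (combine i j)) ≡ rank (tie-broken (accumulated p R i)) j)))
    (Y≡ B S)
    (Execution.algorithm-runs I B S
      (≤-trans (m≤n*m n m {{≢-nonZero λ m≡0 → jobs≢0 (cong (_* n) m≡0)}}) jobs≤size)
      (≤-trans (m≤m*n m n {{≢-nonZero λ n≡0 → jobs≢0 (trans (cong (m *_) n≡0) (*-zeroʳ m))}}) jobs≤size)
      jobs≤size size-positive (≤-trans (k≤2^k S) (^-monoʳ-≤ 2 (m≤n*m S 15)))
      input-bounded (weaken 7 (m≤m+n 7 8) R≤)
      (λ t _ i j → weaken 3 (m≤m+n 3 12) (times≤ₖ (regret p t) i j))
      (λ t _ j → weaken 3 (m≤m+n 3 12) (≤-trans (totals≤ p (regret p t) j) M≤))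
      (λ t t≤R → weaken 15 ≤-refl (≤-trans
        (∑-bound {n} λ j → ≤-trans (*-monoʳ-≤ (regret p t j) (totals≤ p (regret p t) j))
                                   (times-2^ 11 3 (regret≤ₖ t t≤R j) M≤))
        (times-2^ 1 14 n≤ ≤-refl)))
      (λ t t≤R → weaken 12 (m≤m+n 12 3) (≤-trans (∑-bound {n} (regret≤ₖ t t≤R)) (times-2^ 1 11 n≤ ≤-refl)))
      (λ t t≤R → weaken 10 (m≤m+n 10 5) (≤-trans (charged≤ p (weighted≤M p) t) (tM≤ t t≤R)))
      (λ t t≤R i j → weaken 10 (m≤m+n 10 5) (≤-trans (accumulated≤ p t i j) (tM≤ t t≤R)))
      (λ t t≤R j → weaken 11 (m≤m+n 11 4) (sums≤ₖ t t≤R j))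
      jobs≢0)

  no-jobs : m * n ≡ 0 → Fin m → Fin n → ∀ {A : Set} → A
  no-jobs jobs≡0 i j = contradiction (subst (toℕ (combine i j) <_) jobs≡0 (Fin.toℕ<n (combine i j))) λ ()

-- The polynomial time bound

timeFactor : ℕ
timeFactor = 23 + (initialFactor + (sortFactor + 4 * (6 + roundFactor)))

1≤^ : ∀ {s} → 1 ≤ s → ∀ k → 1 ≤ s ^ k
1≤^ {suc s} _ k = m^n>0 (suc s) k

unit≤ : ∀ {s} → 1 ≤ s → suc (15 * s) * (suc s * suc s) ≤ 64 * s ^ 3
unit≤ {s} 1≤s = begin
  suc (15 * s) * (suc s * suc s)            ≤⟨ *-mono-≤ (+-monoˡ-≤ (15 * s) 1≤s) (*-mono-≤ (+-monoˡ-≤ s 1≤s) (+-monoˡ-≤ s 1≤s)) ⟩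
  (s + 15 * s) * ((s + s) * (s + s))        ≡⟨ identity s ⟩
  64 * s ^ 3                                ∎
  where
  open ≤-Reasoning
  identity : ∀ s → (s + 15 * s) * ((s + s) * (s + s)) ≡ 64 * (s * (s * (s * 1)))
  identity = solve-∀

rounds≤ : ∀ {n s} → n ≤ s → rounds n ≤ 4 * s ^ 5
rounds≤ {n} {s} n≤s = ≤-trans
  (*-monoʳ-≤ 4 (*-mono-≤ (*-mono-≤ (*-mono-≤ (*-mono-≤ n≤s n≤s) n≤s) n≤s) n≤s))
  (≤-reflexive (identity s))
  where
  identity : ∀ s → 4 * (s * s * s * s * s) ≡ 4 * (s * (s * (s * (s * (s * 1)))))
  identity = solve-∀

-- The exponent 8 is 5 for the number of rounds plus 3 for the unit of time; constants are raised to
-- the common power using `1 ≤ s`.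
time≤ : ∀ {n s} → 1 ≤ s → n ≤ s →
  (17 + (initialFactor + ((6 + rounds n * (6 + roundFactor)) + sortFactor))) * (suc (15 * s) * (suc s * suc s))
    ≤ timeFactor * 64 * s ^ 8
time≤ {n} {s} 1≤s n≤s = begin
  (17 + (initialFactor + ((6 + rounds n * r) + sortFactor))) * (suc (15 * s) * (suc s * suc s))
    ≤⟨ *-mono-≤ (+-monoʳ-≤ 17 (+-monoʳ-≤ initialFactor (+-monoˡ-≤ sortFactor (+-monoʳ-≤ 6
         (*-monoˡ-≤ r (rounds≤ {n} n≤s)))))) (unit≤ 1≤s) ⟩
  (17 + (initialFactor + ((6 + 4 * s ^ 5 * r) + sortFactor))) * (64 * s ^ 3)
    ≡⟨ cong (_* (64 * s ^ 3)) (regroup initialFactor sortFactor (s ^ 5) r) ⟩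
  ((23 + (initialFactor + sortFactor)) * 1 + 4 * r * s ^ 5) * (64 * s ^ 3)
    ≤⟨ *-monoˡ-≤ (64 * s ^ 3) (+-monoˡ-≤ (4 * r * s ^ 5) (*-monoʳ-≤ (23 + (initialFactor + sortFactor)) (1≤^ 1≤s 5))) ⟩
  ((23 + (initialFactor + sortFactor)) * s ^ 5 + 4 * r * s ^ 5) * (64 * s ^ 3)
    ≡⟨ collect initialFactor sortFactor (s ^ 5) (s ^ 3) r ⟩
  timeFactor * 64 * (s ^ 5 * s ^ 3)
    ≡⟨ cong (timeFactor * 64 *_) (^-distribˡ-+-* s 5 3) ⟨
  timeFactor * 64 * s ^ 8 ∎
  where
  open ≤-Reasoning
  r = 6 + roundFactor
  regroup : ∀ a b x r → 17 + (a + ((6 + 4 * x * r) + b)) ≡ (23 + (a + b)) * 1 + 4 * r * x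
  regroup = solve-∀
  collect : ∀ a b x y r → ((23 + (a + b)) * x + 4 * r * x) * (64 * y) ≡ (23 + (a + (b + 4 * r))) * 64 * (x * y)
  collect = solve-∀

theorem1 : ∃[ prog ] ∃[ c ] ∃[ d ] ((I : Instance) →
    ∃[ s ] ∃[ t ] (⟨ prog , input I ⟩⇓⟨ s , t ⟩ × t ≤ c * size I ^ d ×
    ∃[ π ] (Outputs I s π × K I π ≤ 2 * K* I)))
theorem1 = algorithm , timeFactor * 64 , 8 , solve
  where
  solve : (I : Instance) →
    ∃[ s ] ∃[ t ] (⟨ algorithm , input I ⟩⇓⟨ s , t ⟩ × t ≤ timeFactor * 64 * size I ^ 8 ×
    ∃[ π ] (Outputs I s π × K I π ≤ 2 * K* I))
  solve I = case-jobs (m * n ≟ 0)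
    where
    open Instance I renaming (clients to n; days to m)
    s = size I
    case-jobs : Dec (m * n ≡ 0) →
      ∃[ s ] ∃[ t ] (⟨ algorithm , input I ⟩⇓⟨ s , t ⟩ × t ≤ timeFactor * 64 * size I ^ 8 ×
      ∃[ π ] (Outputs I s π × K I π ≤ 2 * K* I))
    case-jobs (no jobs≢0) =
        proj₁ sorted , proj₁ (proj₂ sorted) , proj₁ (proj₂ (proj₂ sorted))
      , ≤-trans (proj₁ (proj₂ (proj₂ (proj₂ sorted))))
          (time≤ {n} {s} (size-positive I) (≤-trans (m≤n*m n m {{≢-nonZero λ m≡0 → jobs≢0 (cong (_* n) m≡0)}}) (jobs≤size I)))
      , sorted-2-approximation I (λ i j → proj₁ sorted 2 (toℕ (combine i j)))
          (proj₂ (proj₂ (proj₂ (proj₂ sorted))))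
      where sorted = sorted-rows I jobs≢0
    case-jobs (yes jobs≡0) =
        _ , _ , ⇓-else jobs≡0 ⇓-skip
      , (begin
          1 + (cost jobsE (input I) + 1)   ≤⟨ s≤s (+-mono-≤ (cost≤ (input-bounded I) jobsE) (s≤s z≤n)) ⟩
          1 + (16 * suc (15 * s) + suc (15 * s)) ≤⟨ +-monoˡ-≤ _ (size-positive I) ⟩
          s + (16 * suc (15 * s) + suc (15 * s)) ≡⟨ identity s ⟩
          17 * 1 + 256 * s                 ≤⟨ +-monoˡ-≤ (256 * s) (*-monoʳ-≤ 17 (size-positive I)) ⟩
          17 * s + 256 * s                 ≡⟨ *-distribʳ-+ s 17 256 ⟨
          273 * s                          ≤⟨ *-mono-≤ {273} {timeFactor * 64}
                                                (≤-trans (m≤m+n 273 1199) (*-monoˡ-≤ 64 {23} {timeFactor} (m≤m+n 23 (initialFactor + (sortFactor + 4 * (6 + roundFactor)))))) s≤s^8 ⟩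
          timeFactor * 64 * s ^ 8          ∎)
      , (λ _ → id) , (λ i j → no-jobs I jobs≡0 i j)
      -- A client together with a day would be a job. All totals are therefore empty sums, and any
      -- schedule has cost 0.
      , max≤ (totalCompletionTime I (λ _ → id)) (λ j → ≤-trans
          (∑-mono {m} {g = λ _ → 0} λ i → no-jobs I jobs≡0 i j)
          (≤-trans (≤-reflexive (∑-zero {m} λ _ → refl)) z≤n))
      where
      open ≤-Reasoning
      identity : ∀ s → s + (16 * suc (15 * s) + suc (15 * s)) ≡ 17 * 1 + 256 * s
      identity = solve-∀
      s≤s^8 : s ≤ s ^ 8
      s≤s^8 = ≤-trans (≤-reflexive (sym (*-identityʳ s))) (*-monoʳ-≤ s (1≤^ (size-positive I) 7))
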